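{- For every term $M$ of $\ell\Lambda_\infty^{4S}$ there is a normal form $N$, itself a term of $\ell\Lambda_\infty^{4S}$, such that $M\Rightarrow N$.
   Context: Preterms: possibly infinite trees generated by $M ::= x \mid MN \mid \lambda x.M \mid \lambda^{\downarrow}x.M \mid \lambda^{\uparrow}x.M \mid \downarrow M \mid \uparrow M$ ($\downarrow M$ inductive box, $\uparrow M$ coinductive box); substitution is capture-avoiding. Patterns: $x,\downarrow x,\uparrow x,\#x,\dagger x$; environments: finite sets of patterns, each variable in at most one; $\Theta,\Xi,\Psi,\Phi$ linear environments with marked versions $\#\Theta$ etc.; $\Upsilon,\Pi$ environments with only patterns $y$, $\downarrow y$; commas are disjoint unions. A term of $\ell\Lambda_\infty^{4S}$ is a preterm $M$ with $\Gamma\vdash M$ derivable for some $\Gamma$ by: (vl) $\#\Theta,\uparrow\Xi,\dagger\Psi,x\vdash x$; (vd) $\#\Theta,\uparrow\Xi,\dagger\Psi,\#x\vdash x$; (va) $\#\Theta,\uparrow\Xi,\dagger\Psi,\dagger x\vdash x$; (a) from $\Upsilon,\#\Theta,\uparrow\Xi,\dagger\Psi\vdash M$ and $\Pi,\#\Theta,\uparrow\Xi,\dagger\Psi\vdash N$ infer $\Upsilon,\Pi,\#\Theta,\uparrow\Xi,\dagger\Psi\vdash MN$; (ll) $\Gamma,x\vdash M$ gives $\Gamma\vdash\lambda x.M$; (li)$_1$ $\Gamma,\#x\vdash M$ gives $\Gamma\vdash\lambda^\downarrow x.M$; (li)$_2$ $\Gamma,\downarrow x\vdash M$ gives $\Gamma\vdash\lambda^\downarrow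 x.M$; (lc) $\Gamma,\uparrow x\vdash M$ gives $\Gamma\vdash\lambda^\uparrow x.M$; (mi) from $\Xi,\uparrow\Psi,\dagger\Phi\vdash M$ infer $\#\Theta,\downarrow\Xi,\uparrow\Psi,\dagger\Phi\vdash\downarrow M$; (mc) from $\dagger\Xi,\dagger\Psi\vdash M$ infer $\#\Theta,\uparrow\Xi,\dagger\Psi\vdash\uparrow M$; (mc) coinductive, others inductive (every infinite branch of a derivation contains infinitely many (mc)). Basic reduction: $(\lambda x.M)N\mapsto M[N/x]$, $(\lambda^\downarrow x.M)(\downarrow N)\mapsto M[N/x]$, $(\lambda^\uparrow x.M)(\uparrow N)\mapsto M[N/x]$; $M\to N$ iff $M=C[L]$, $N=C[P]$, $L\mapsto P$ for a one-hole context $C$. A normal form is a preterm $N$ with no $N'$ such that $N\to N'$. Infinitary reduction $\Rightarrow$ and the auxiliary relation $\leadsto$ are given by the mixed formal system: (coinductive rule) if $M\to^*N$ and $N\leadsto L$ then $M\Rightarrow L$; (inductive rules) $x\leadsto x$; if $M\leadsto N$ and $L\leadsto P$ then $ML\leadsto NP$; if $M\leadsto N$ then $\lambda x.M\leadsto\lambda x.N$, $\lambda^\downarrow x.M\leadsto\lambda^\downarrow x.N$, $\lambda^\uparrow x.M\leadsto\lambda^\uparrow x.N$ and $\downarrow M\leadsto\downarrow N$; if $M\Rightarrow N$ then $\uparrow M\leadsto\uparrow N$. A judgment holds iff it is the root of a possibly infinite derivation tree in which every infinite branch uses the coinductive rule infinitely often. -}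

module Defs where

open import Level using (0ℓ) renaming (suc to lsuc)
open import Data.Empty using (⊥)
open import Data.List.Base using (List; []; _∷_)
open import Data.List.Relation.Binary.Pointwise using (Pointwise)
open import Data.List.Relation.Unary.All using (All)
open import Data.Maybe.Base using (Maybe; just; nothing)
open import Data.Nat.Base using (ℕ; zero; suc)
open import Data.Product.Base using (Σ-syntax; ∃-syntax; _×_)
open import Data.Unit.Base using (⊤)
open import Relation.Binary.Construct.Closure.ReflexiveTransitive using (Star)
open import Relation.Binary.Core using (Rel; REL)
open import Relation.Binary.PropositionalEquality.Core using (_≡_)
open import Relation.Nullary.Negation.Core using (¬_)

-- Preterms are possibly infinite trees, taken up to α-equivalence by means of
-- de Bruijn indices (a preterm may have infinitely many free variables).
-- A tree is the function sending a position, i.e. a finite path from the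
-- root, to the label found there.  Values at paths that leave the tree (below
-- a variable, or to the right below a unary node) are meaningless; equality
-- of trees is _≈_, which ignores them.

data Dir : Set where
  left right : Dir

data Label : Set where
  var               : ℕ → Label
  app               : Label
  lam lam↓ lam↑     : Label
  box↓ box↑         : Label

Preterm : Set
Preterm = List Dir → Label

child : Dir → Preterm → Preterm
child d M p = M (d ∷ p)

HasChild : Label → Dir → Set
HasChild (var _) _     = ⊥
HasChild app     _     = ⊤
HasChild _       left  = ⊤
HasChild _       right = ⊥

IsPosition : Preterm → List Dir → Set
IsPosition M []      = ⊤
IsPosition M (d ∷ p) = HasChild (M []) d × IsPosition (child d M) p

infix 4 _≈_

-- Agreement on the positions of M forces N to have the same positions, so
-- this is symmetric.
record _≈_ (M N : Preterm) : Set where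
  constructor mk≈
  field
    agree : ∀ p → IsPosition M p → M p ≡ N p

unary : Label → Preterm → Preterm
unary l M []      = l
unary l M (_ ∷ p) = M p

infix  9 `_
infixl 8 _·_
infixr 7 ƛ_ ƛ↓_ ƛ↑_ ↓_ ↑_

`_ : ℕ → Preterm
(` x) _ = var x

_·_ : Preterm → Preterm → Preterm
(M · N) []          = app
(M · N) (left  ∷ p) = M p
(M · N) (right ∷ p) = N p

ƛ_ ƛ↓_ ƛ↑_ ↓_ ↑_ : Preterm → Preterm
ƛ_  = unary lam
ƛ↓_ = unary lam↓
ƛ↑_ = unary lam↑
↓_  = unary box↓
↑_  = unary box↑

liftʳ : (ℕ → ℕ) → (ℕ → ℕ)
liftʳ ρ zero    = zero
liftʳ ρ (suc x) = suc (ρ x)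

underʳ : Label → (ℕ → ℕ) → (ℕ → ℕ)
underʳ lam  ρ = liftʳ ρ
underʳ lam↓ ρ = liftʳ ρ
underʳ lam↑ ρ = liftʳ ρ
underʳ _    ρ = ρ

-- The first argument of renameAt and substAt is the root label of the tree
-- acted upon.
renameAt : Label → (ℕ → ℕ) → Preterm → Preterm
renameAt (var x) ρ M _       = var (ρ x)
renameAt l       ρ M []      = l
renameAt l       ρ M (d ∷ p) = renameAt (M (d ∷ [])) (underʳ l ρ) (child d M) p

rename : (ℕ → ℕ) → Preterm → Preterm
rename ρ M = renameAt (M []) ρ M

liftˢ : (ℕ → Preterm) → (ℕ → Preterm)
liftˢ σ zero    = ` zero
liftˢ σ (suc x) = rename suc (σ x)

underˢ : Label → (ℕ → Preterm) → (ℕ → Preterm)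
underˢ lam  σ = liftˢ σ
underˢ lam↓ σ = liftˢ σ
underˢ lam↑ σ = liftˢ σ
underˢ _    σ = σ

substAt : Label → (ℕ → Preterm) → Preterm → Preterm
substAt (var x) σ M p       = σ x p
substAt l       σ M []      = l
substAt l       σ M (d ∷ p) = substAt (M (d ∷ [])) (underˢ l σ) (child d M) p

substitute : (ℕ → Preterm) → Preterm → Preterm
substitute σ M = substAt (M []) σ M

single : Preterm → (ℕ → Preterm)
single N zero    = N
single N (suc x) = ` x

infix 10 _[_]

-- M[N/x], where x is the variable with index 0 in M.
_[_] : Preterm → Preterm → Preterm
M [ N ] = substitute (single N) M

-- Greatest fixed point.  F is instantiated below with inductive families in
-- which X stands for the premises that sit behind the coinductive rule, so a
-- post-fixed point X describes exactly the possibly infinite derivation trees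
-- in which every infinite branch uses that rule infinitely often.
ν : ∀ {A B : Set} → (REL A B 0ℓ → REL A B 0ℓ) → REL A B (lsuc 0ℓ)
ν {A} {B} F a b = Σ[ X ∈ REL A B 0ℓ ] (∀ {a b} → X a b → F X a b) × X a b

-- The patterns  x, ↓x, ↑x, #x, †x.
data Pattern : Set where
  plain down up hash dagger : Pattern

-- The entry at index x is the pattern in which the variable x occurs, if any;
-- variables beyond the end of the list do not occur.
Slot Env : Set
Slot = Maybe Pattern
Env  = List Slot

-- Slots of environments of the form  #Θ, ↑Ξ, †Ψ.
data Shared : Slot → Set where
  absent : Shared nothing
  hash   : Shared (just hash)
  up     : Shared (just up)
  dagger : Shared (just dagger)

-- Axiom π Γ x: the environment Γ is  #Θ, ↑Ξ, †Ψ, π x.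
data Axiom (π : Pattern) : Env → ℕ → Set where
  here  : ∀ {Γ} → All Shared Γ → Axiom π (just π ∷ Γ) zero
  there : ∀ {s Γ x} → Shared s → Axiom π Γ x → Axiom π (s ∷ Γ) (suc x)

-- Patterns of Υ and Π.
data Unshared : Pattern → Set where
  plain : Unshared plain
  down  : Unshared down

data SplitSlot : Slot → Slot → Slot → Set where
  toˡ  : ∀ {π} → Unshared π → SplitSlot (just π) (just π) nothing
  toʳ  : ∀ {π} → Unshared π → SplitSlot (just π) nothing (just π)
  both : ∀ {s} → Shared s → SplitSlot s s s

-- Split Γ Δ₁ Δ₂:  Γ = Υ, Π, #Θ, ↑Ξ, †Ψ  with  Δ₁ = Υ, #Θ, ↑Ξ, †Ψ  and
-- Δ₂ = Π, #Θ, ↑Ξ, †Ψ.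
data Split : Env → Env → Env → Set where
  []  : Split [] [] []
  _∷_ : ∀ {s s₁ s₂ Γ Δ₁ Δ₂} → SplitSlot s s₁ s₂ → Split Γ Δ₁ Δ₂ →
        Split (s ∷ Γ) (s₁ ∷ Δ₁) (s₂ ∷ Δ₂)

-- Conclusion  #Θ, ↓Ξ, ↑Ψ, †Φ  against premise  Ξ, ↑Ψ, †Φ.
data Box↓Slot : Rel Slot 0ℓ where
  absent : Box↓Slot nothing       nothing
  hash   : Box↓Slot (just hash)   nothing
  down   : Box↓Slot (just down)   (just plain)
  up     : Box↓Slot (just up)     (just up)
  dagger : Box↓Slot (just dagger) (just dagger)

-- Conclusion  #Θ, ↑Ξ, †Ψ  against premise  †Ξ, †Ψ.
data Box↑Slot : Rel Slot 0ℓ where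
  absent : Box↑Slot nothing       nothing
  hash   : Box↑Slot (just hash)   nothing
  up     : Box↑Slot (just up)     (just dagger)
  dagger : Box↑Slot (just dagger) (just dagger)

data Derivation (X : REL Env Preterm 0ℓ) (Γ : Env) (M : Preterm) : Set where
  vl  : ∀ {x} → M ≈ ` x → Axiom plain Γ x → Derivation X Γ M
  vd  : ∀ {x} → M ≈ ` x → Axiom hash Γ x → Derivation X Γ M
  va  : ∀ {x} → M ≈ ` x → Axiom dagger Γ x → Derivation X Γ M
  a   : ∀ {L N Δ₁ Δ₂} → M ≈ L · N → Split Γ Δ₁ Δ₂ →
        Derivation X Δ₁ L → Derivation X Δ₂ N → Derivation X Γ M
  ll  : ∀ {L} → M ≈ ƛ L → Derivation X (just plain ∷ Γ) L → Derivation X Γ M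
  li₁ : ∀ {L} → M ≈ ƛ↓ L → Derivation X (just hash ∷ Γ) L → Derivation X Γ M
  li₂ : ∀ {L} → M ≈ ƛ↓ L → Derivation X (just down ∷ Γ) L → Derivation X Γ M
  lc  : ∀ {L} → M ≈ ƛ↑ L → Derivation X (just up ∷ Γ) L → Derivation X Γ M
  mi  : ∀ {L Δ} → M ≈ ↓ L → Pointwise Box↓Slot Γ Δ → Derivation X Δ L →
        Derivation X Γ M
  mc  : ∀ {L Δ} → M ≈ ↑ L → Pointwise Box↑Slot Γ Δ → X Δ L → Derivation X Γ M

infix 4 _⊢_

_⊢_ : Env → Preterm → Set₁
_⊢_ = ν Derivation

Term : Preterm → Set₁
Term M = ∃[ Γ ] Γ ⊢ M

infix 4 _↦_ _⟶_ _⟶*_ _⇒_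

data _↦_ : Rel Preterm 0ℓ where
  β  : ∀ M N → (ƛ M) · N ↦ M [ N ]
  β↓ : ∀ M N → (ƛ↓ M) · (↓ N) ↦ M [ N ]
  β↑ : ∀ M N → (ƛ↑ M) · (↑ N) ↦ M [ N ]

data Context : Set where
  □              : Context
  _·ˡ_           : Context → Preterm → Context
  _·ʳ_           : Preterm → Context → Context
  lam lam↓ lam↑  : Context → Context
  box↓ box↑      : Context → Context

-- Filling the hole may capture variables, so nothing is shifted.
_⟨_⟩ : Context → Preterm → Preterm
□        ⟨ L ⟩ = L
(C ·ˡ N) ⟨ L ⟩ = (C ⟨ L ⟩) · N
(M ·ʳ C) ⟨ L ⟩ = M · (C ⟨ L ⟩)
lam C    ⟨ L ⟩ = ƛ (C ⟨ L ⟩)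
lam↓ C   ⟨ L ⟩ = ƛ↓ (C ⟨ L ⟩)
lam↑ C   ⟨ L ⟩ = ƛ↑ (C ⟨ L ⟩)
box↓ C   ⟨ L ⟩ = ↓ (C ⟨ L ⟩)
box↑ C   ⟨ L ⟩ = ↑ (C ⟨ L ⟩)

data _⟶_ (M N : Preterm) : Set where
  step : ∀ C {L P} → M ≈ C ⟨ L ⟩ → N ≈ C ⟨ P ⟩ → L ↦ P → M ⟶ N

_⟶*_ : Rel Preterm 0ℓ
_⟶*_ = Star _⟶_

NormalForm : Preterm → Set
NormalForm N = ∀ N′ → ¬ (N ⟶ N′)

-- The inductive rules, deriving  M ⇝ N  from judgments  L ⇒ P  taken in X.
data Inside (X : Rel Preterm 0ℓ) (M N : Preterm) : Set where
  var  : ∀ {x} → M ≈ ` x → N ≈ ` x → Inside X M N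
  app  : ∀ {M₁ M₂ N₁ N₂} → M ≈ M₁ · M₂ → N ≈ N₁ · N₂ →
         Inside X M₁ N₁ → Inside X M₂ N₂ → Inside X M N
  lam  : ∀ {L P} → M ≈ ƛ L → N ≈ ƛ P → Inside X L P → Inside X M N
  lam↓ : ∀ {L P} → M ≈ ƛ↓ L → N ≈ ƛ↓ P → Inside X L P → Inside X M N
  lam↑ : ∀ {L P} → M ≈ ƛ↑ L → N ≈ ƛ↑ P → Inside X L P → Inside X M N
  box↓ : ∀ {L P} → M ≈ ↓ L → N ≈ ↓ P → Inside X L P → Inside X M N
  box↑ : ∀ {L P} → M ≈ ↑ L → N ≈ ↑ P → X L P → Inside X M N

data Reduces (X : Rel Preterm 0ℓ) (M L : Preterm) : Set where
  reduces : ∀ {N} → M ⟶* N → Inside X N L → Reduces X M L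

_⇒_ : Preterm → Preterm → Set₁
_⇒_ = ν Reduces

{-# OPTIONS --safe #-}
module Submission where

-- The part of a term outside its ↑-boxes (its skeleton) is finite.  For n ≥ 2,
-- give each occurrence of a variable there the weight n ^ d, where d counts the
-- surrounding ↓-boxes.  For large n, typability amounts to this: a variable
-- bound by λ has weight 1; one bound by λ↓ has weight at most n (at most n
-- occurrences outside boxes, or a single one inside exactly one ↓-box); one
-- bound by λ↑ has weight 0 (it lives inside ↑-boxes).  Weights are linear under
-- substitution, so these conditions survive reduction, and the size in which
-- ↓-boxes count n-fold decreases at every step outside the ↑-boxes; contents of
-- ↑-boxes do not count, since reducing a λ↑-redex only moves them into other
-- ↑-boxes.  Normalising the skeleton, and then corecursively the contents of its
-- ↑-boxes, yields the normal form: the second phase changes no label of the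
-- skeleton, hence creates no redex there.

open import Level using (0ℓ)
open import Data.Bool.Base using (Bool; true; false)
open import Data.Empty using (⊥; ⊥-elim)
open import Data.List.Base using (List; []; _∷_; map)
open import Data.List.Relation.Binary.Pointwise using (Pointwise; []; _∷_)
open import Data.List.Relation.Unary.All using (All; []; _∷_)
open import Data.Maybe.Base using (just; nothing)
open import Data.Nat.Base using (ℕ; zero; suc; _+_; _*_; _⊔_; _≤_; _<_; z≤n; s≤s; s≤s⁻¹)
open import Data.Nat.Properties
open import Data.Nat.Tactic.RingSolver using (solve-∀)
open import Data.Product.Base using (Σ-syntax; ∃-syntax; ∃₂; _×_; _,_; proj₁; proj₂)
open import Data.Sum.Base using (_⊎_; inj₁; inj₂)
open import Data.Unit.Base using (⊤; tt)
open import Function.Base using (_∘_)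
open import Relation.Binary.Construct.Closure.ReflexiveTransitive using (ε; _◅_)
open import Relation.Binary.Core using (REL)
open import Relation.Binary.PropositionalEquality
  using (_≡_; refl; sym; trans; cong; cong₂; subst; subst₂; module ≡-Reasoning)
open import Defs

open _≈_

-- Trees up to ≈

≈-refl : ∀ {M} → M ≈ M
≈-refl = mk≈ λ _ _ → refl

≈-child : ∀ {M N} d → HasChild (M []) d → M ≈ N → child d M ≈ child d N
≈-child d c e = mk≈ λ p i → agree e (d ∷ p) (c , i)

position-≈ : ∀ {M N} → M ≈ N → ∀ p → IsPosition M p → IsPosition N p
position-≈ e []      _       = tt
position-≈ e (d ∷ p) (c , i) =
  subst (λ l → HasChild l d) (agree e [] tt) c , position-≈ (≈-child d c e) p i

position-≈⁻ : ∀ {M N} → M ≈ N → ∀ p → IsPosition N p → IsPosition M p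
position-≈⁻ e []      _       = tt
position-≈⁻ {M} e (d ∷ p) (c , i) = c′ , position-≈⁻ (≈-child d c′ e) p i
  where
  c′ : HasChild (M []) d
  c′ = subst (λ l → HasChild l d) (sym (agree e [] tt)) c

≈-sym : ∀ {M N} → M ≈ N → N ≈ M
≈-sym e = mk≈ λ p i → sym (agree e p (position-≈⁻ e p i))

≈-trans : ∀ {M N P} → M ≈ N → N ≈ P → M ≈ P
≈-trans e f = mk≈ λ p i → trans (agree e p i) (agree f p (position-≈ e p i))

·-cong : ∀ {M M′ N N′} → M ≈ M′ → N ≈ N′ → M · N ≈ M′ · N′
·-cong e f = mk≈ λ where
  []          _       → refl
  (left  ∷ p) (_ , i) → agree e p i
  (right ∷ p) (_ , i) → agree f p i

unary-cong : ∀ l {M N} → M ≈ N → unary l M ≈ unary l N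
unary-cong l e = mk≈ λ where
  []      _       → refl
  (_ ∷ p) (_ , i) → agree e p i

rename-cong : ∀ ρ {M N} → M ≈ N → rename ρ M ≈ rename ρ N
rename-cong ρ e = mk≈ λ p → go p ρ e
  where
  go : ∀ p ρ {M N} → M ≈ N → IsPosition (rename ρ M) p → rename ρ M p ≡ rename ρ N p
  -- The equalities between children are abstracted along with the root label, so that matching on
  -- the label reduces their `HasChild` premise to the unit type. The recursion is on the path.
  go p ρ {M} {N} e i with M [] | N [] | agree e [] tt | (λ d c → ≈-child d c e)
  go p           ρ e i       | var x | _ | refl | _ = refl
  go []          ρ e i       | app   | _ | refl | _ = refl
  go (d ∷ p)     ρ e (_ , i) | app   | _ | refl | h = go p _ (h d tt) i
  go []          ρ e i       | lam   | _ | refl | _ = refl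
  go (left ∷ p)  ρ e (_ , i) | lam   | _ | refl | h = go p _ (h left tt) i
  go []          ρ e i       | lam↓  | _ | refl | _ = refl
  go (left ∷ p)  ρ e (_ , i) | lam↓  | _ | refl | h = go p _ (h left tt) i
  go []          ρ e i       | lam↑  | _ | refl | _ = refl
  go (left ∷ p)  ρ e (_ , i) | lam↑  | _ | refl | h = go p _ (h left tt) i
  go []          ρ e i       | box↓  | _ | refl | _ = refl
  go (left ∷ p)  ρ e (_ , i) | box↓  | _ | refl | h = go p _ (h left tt) i
  go []          ρ e i       | box↑  | _ | refl | _ = refl
  go (left ∷ p)  ρ e (_ , i) | box↑  | _ | refl | h = go p _ (h left tt) i

substitute-cong : ∀ σ {M N} → M ≈ N → substitute σ M ≈ substitute σ N
substitute-cong σ e = mk≈ λ p → go p σ e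
  where
  go : ∀ p σ {M N} → M ≈ N → IsPosition (substitute σ M) p → substitute σ M p ≡ substitute σ N p
  go p σ {M} {N} e i with M [] | N [] | agree e [] tt | (λ d c → ≈-child d c e)
  go p           σ e i       | var x | _ | refl | _ = refl
  go []          σ e i       | app   | _ | refl | _ = refl
  go (d ∷ p)     σ e (_ , i) | app   | _ | refl | h = go p _ (h d tt) i
  go []          σ e i       | lam   | _ | refl | _ = refl
  go (left ∷ p)  σ e (_ , i) | lam   | _ | refl | h = go p _ (h left tt) i
  go []          σ e i       | lam↓  | _ | refl | _ = refl
  go (left ∷ p)  σ e (_ , i) | lam↓  | _ | refl | h = go p _ (h left tt) i
  go []          σ e i       | lam↑  | _ | refl | _ = refl
  go (left ∷ p)  σ e (_ , i) | lam↑  | _ | refl | h = go p _ (h left tt) i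
  go []          σ e i       | box↓  | _ | refl | _ = refl
  go (left ∷ p)  σ e (_ , i) | box↓  | _ | refl | h = go p _ (h left tt) i
  go []          σ e i       | box↑  | _ | refl | _ = refl
  go (left ∷ p)  σ e (_ , i) | box↑  | _ | refl | h = go p _ (h left tt) i

-- Redexes as label patterns

-- Whether a node is a redex is decided by its label and those of its children. Rewriting deeper
-- down, in particular normalising the contents of ↑-boxes, therefore cannot create a redex as long
-- as labels are kept.
topRedex : Label → Label → Label → Bool
topRedex app lam  _    = true
topRedex app lam↓ box↓ = true
topRedex app lam↑ box↑ = true
topRedex _   _    _    = false

redexAt : Preterm → List Dir → Bool
redexAt M []      = topRedex (M []) (M (left ∷ [])) (M (right ∷ []))
redexAt M (d ∷ p) = redexAt (child d M) p

redexAt-≈ : ∀ {M N} → M ≈ N → ∀ p → IsPosition M p → redexAt M p ≡ redexAt N p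
redexAt-≈ {M} {N} e [] _ with M [] | N [] | agree e [] tt | (λ d c → agree (≈-child d c e) [] tt)
... | var _ | _ | refl | _ = refl
... | app   | _ | refl | h = cong₂ (topRedex app) (h left tt) (h right tt)
... | lam   | _ | refl | _ = refl
... | lam↓  | _ | refl | _ = refl
... | lam↑  | _ | refl | _ = refl
... | box↓  | _ | refl | _ = refl
... | box↑  | _ | refl | _ = refl
redexAt-≈ e (d ∷ p) (c , i) = redexAt-≈ (≈-child d c e) p i

hole : Context → List Dir
hole □        = []
hole (C ·ˡ _) = left ∷ hole C
hole (_ ·ʳ C) = right ∷ hole C
hole (lam C)  = left ∷ hole C
hole (lam↓ C) = left ∷ hole C
hole (lam↑ C) = left ∷ hole C
hole (box↓ C) = left ∷ hole C
hole (box↑ C) = left ∷ hole C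

hole-position : ∀ C L → IsPosition (C ⟨ L ⟩) (hole C)
hole-position □        L = tt
hole-position (C ·ˡ _) L = tt , hole-position C L
hole-position (_ ·ʳ C) L = tt , hole-position C L
hole-position (lam C)  L = tt , hole-position C L
hole-position (lam↓ C) L = tt , hole-position C L
hole-position (lam↑ C) L = tt , hole-position C L
hole-position (box↓ C) L = tt , hole-position C L
hole-position (box↑ C) L = tt , hole-position C L

hole-redex : ∀ C {L P} → L ↦ P → redexAt (C ⟨ L ⟩) (hole C) ≡ true
hole-redex □        (β  _ _) = refl
hole-redex □        (β↓ _ _) = refl
hole-redex □        (β↑ _ _) = refl
hole-redex (C ·ˡ _) r = hole-redex C r
hole-redex (_ ·ʳ C) r = hole-redex C r
hole-redex (lam C)  r = hole-redex C r
hole-redex (lam↓ C) r = hole-redex C r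
hole-redex (lam↑ C) r = hole-redex C r
hole-redex (box↓ C) r = hole-redex C r
hole-redex (box↑ C) r = hole-redex C r

-- A step contracts a redex at the hole of its context. That hole is a genuine position of `N`, and
-- there `redexAt` does not distinguish trees related by `≈`.
redex-free⇒normal : ∀ {N} → (∀ p → IsPosition N p → redexAt N p ≡ false) → NormalForm N
redex-free⇒normal free _ (step C {L} e _ r)
  with i ← position-≈⁻ e (hole C) (hole-position C L)
  with () ← trans (sym (free (hole C) i)) (trans (redexAt-≈ e (hole C) i) (hole-redex C r))

⟶-≈ˡ : ∀ {M M′ N} → M ≈ M′ → M′ ⟶ N → M ⟶ N
⟶-≈ˡ e (step C e₁ e₂ r) = step C (≈-trans e e₁) e₂ r

-- Environments as functions

slot : Env → ℕ → Slot
slot []      _       = nothing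
slot (s ∷ Γ) zero    = s
slot (s ∷ Γ) (suc y) = slot Γ y

slot-split : ∀ {Γ Δ₁ Δ₂} → Split Γ Δ₁ Δ₂ → ∀ y → SplitSlot (slot Γ y) (slot Δ₁ y) (slot Δ₂ y)
slot-split []      y       = both absent
slot-split (q ∷ _) zero    = q
slot-split (_ ∷ t) (suc y) = slot-split t y

slot-pointwise : ∀ {R : Slot → Slot → Set} {Γ Δ} → R nothing nothing →
                 Pointwise R Γ Δ → ∀ y → R (slot Γ y) (slot Δ y)
slot-pointwise r []      y       = r
slot-pointwise r (q ∷ _) zero    = q
slot-pointwise r (_ ∷ t) (suc y) = slot-pointwise r t y

slot-shared : ∀ {Γ} → All Shared Γ → ∀ y → Shared (slot Γ y)
slot-shared []      y       = absent
slot-shared (q ∷ _) zero    = q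
slot-shared (_ ∷ t) (suc y) = slot-shared t y

slot-axiom : ∀ {π Γ x} → Axiom π Γ x → slot Γ x ≡ just π
slot-axiom (here _)    = refl
slot-axiom (there _ t) = slot-axiom t

all-shared : ∀ Γ → (∀ y → Shared (slot Γ y)) → All Shared Γ
all-shared []      _ = []
all-shared (s ∷ Γ) h = h zero ∷ all-shared Γ (h ∘ suc)

-- Only the listed slots need a choice: beyond the end of `Γ` the slot is `nothing`, which splits
-- only into two absent slots.
choose-split : ∀ Γ {P Q : ℕ → Slot → Set} →
  (∀ y → ∃₂ λ s t → SplitSlot (slot Γ y) s t × P y s × Q y t) →
  ∃₂ λ Δ₁ Δ₂ → Split Γ Δ₁ Δ₂ × (∀ y → P y (slot Δ₁ y)) × (∀ y → Q y (slot Δ₂ y))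
choose-split [] {P} {Q} f = [] , [] , [] , (λ y → proj₁ (g y)) , (λ y → proj₂ (g y))
  where
  g : ∀ y → P y nothing × Q y nothing
  g y with _ , _ , both absent , pq ← f y = pq
choose-split (s ∷ Γ) f
  with s₁ , s₂ , q , p₀ , q₀ ← f zero
     | Δ₁ , Δ₂ , t , ps , qs ← choose-split Γ (f ∘ suc)
  = s₁ ∷ Δ₁ , s₂ ∷ Δ₂ , q ∷ t
  , (λ { zero → p₀ ; (suc y) → ps y }) , (λ { zero → q₀ ; (suc y) → qs y })

-- The first hypothesis makes the companion of an absent slot absent, so a `Δ` of the length of `Γ`
-- satisfies `P` at every index.
choose-pointwise : ∀ {R : Slot → Slot → Set} Γ {P : ℕ → Slot → Set} →
  (∀ {s} → R nothing s → s ≡ nothing) →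
  (∀ y → ∃[ s ] R (slot Γ y) s × P y s) →
  ∃[ Δ ] Pointwise R Γ Δ × (∀ y → P y (slot Δ y))
choose-pointwise {R} [] {P} r f = [] , [] , g
  where
  g : ∀ y → P y nothing
  g y with _ , q , p ← f y with refl ← r q = p
choose-pointwise (s ∷ Γ) r f
  with s₁ , q , p₀ ← f zero | Δ , t , ps ← choose-pointwise Γ r (f ∘ suc)
  = s₁ ∷ Δ , q ∷ t , λ { zero → p₀ ; (suc y) → ps y }

-- Arithmetic

δ : ℕ → ℕ → ℕ
δ zero    zero    = 1
δ zero    (suc _) = 0
δ (suc _) zero    = 0
δ (suc x) (suc y) = δ x y

δ-refl : ∀ x → δ x x ≡ 1
δ-refl zero    = refl
δ-refl (suc x) = δ-refl x

δ≡0⊎≡ : ∀ x y → δ x y ≡ 0 ⊎ x ≡ y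
δ≡0⊎≡ zero    zero    = inj₂ refl
δ≡0⊎≡ zero    (suc _) = inj₁ refl
δ≡0⊎≡ (suc _) zero    = inj₁ refl
δ≡0⊎≡ (suc x) (suc y) with δ≡0⊎≡ x y
... | inj₁ e = inj₁ e
... | inj₂ e = inj₂ (cong suc e)

infix 4 _≼_

-- Exact below 2, so that linear variables stay linear.
_≼_ : ℕ → ℕ → Set
m ≼ n = m ≤ n × (n ≤ 1 → m ≡ n)

≼-reflexive : ∀ {m n} → m ≡ n → m ≼ n
≼-reflexive e = ≤-reflexive e , λ _ → e

≼-+ˡ : ∀ k {m n} → m ≼ n → m + k ≼ n + k
≼-+ˡ k {_} {n} (l , e) = +-monoˡ-≤ k l , λ h → cong (_+ k) (e (≤-trans (m≤m+n n k) h))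

≼-+ʳ : ∀ k {m n} → m ≼ n → k + m ≼ k + n
≼-+ʳ k {_} {n} (l , e) = +-monoʳ-≤ k l , λ h → cong (k +_) (e (≤-trans (m≤n+m n k) h))

n*m≤1⇒m≡0 : ∀ {n} m → 2 ≤ n → n * m ≤ 1 → m ≡ 0
n*m≤1⇒m≡0 zero    _ _ = refl
n*m≤1⇒m≡0 {n} (suc m) h l
  with s≤s () ← ≤-trans h (≤-trans (m≤m*n n (suc m)) l)

≼-* : ∀ {n m′ m} → 2 ≤ n → m′ ≼ m → n * m′ ≼ n * m
≼-* {n} {m′} {m} h (l , e) = *-monoʳ-≤ n l , λ q →
  cong (n *_) (e (subst (_≤ 1) (sym (n*m≤1⇒m≡0 m h q)) z≤n))

-- The change of weight when a λ↓-redex is contracted: `p` comes from the body, `q` from the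
-- argument, which counted `n` times in its ↓-box and now counts `m` times. If the total was at most
-- 1, then `q` is 0 and nothing changes.
≼-opening : ∀ {n m} p q → 2 ≤ n → m ≤ n → p + m * q ≼ p + n * q
≼-opening {n} {m} p q h l = +-monoʳ-≤ p (*-monoˡ-≤ q l) , λ r →
  cong (p +_) (trans (vanish m (q≡0 r)) (sym (vanish n (q≡0 r))))
  where
  q≡0 : p + n * q ≤ 1 → q ≡ 0
  q≡0 r = n*m≤1⇒m≡0 q h (≤-trans (m≤n+m (n * q) p) r)
  vanish : ∀ k → q ≡ 0 → k * q ≡ 0
  vanish k refl = *-zeroʳ k

m+n≡1-cases : ∀ m {n} → m + n ≡ 1 → (m ≡ 0 × n ≡ 1) ⊎ (m ≡ 1 × n ≡ 0)
m+n≡1-cases zero       e = inj₁ (refl , e)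
m+n≡1-cases (suc zero) e = inj₂ (refl , suc-injective e)

sum-linear : ∀ p q r s c → (p + q * c) + (r + s * c) ≡ (p + r) + (q + s) * c
sum-linear = solve-∀

scale-linear : ∀ n p q c → n * (p + q * c) ≡ n * p + n * q * c
scale-linear = solve-∀

-- Constructors and binders

rename-· : ∀ ρ M N → rename ρ M · rename ρ N ≈ rename ρ (M · N)
rename-· ρ M N = mk≈ λ where
  []          _ → refl
  (left  ∷ p) _ → refl
  (right ∷ p) _ → refl

substitute-· : ∀ σ M N → substitute σ M · substitute σ N ≈ substitute σ (M · N)
substitute-· σ M N = mk≈ λ where
  []          _ → refl
  (left  ∷ p) _ → refl
  (right ∷ p) _ → refl

data Binder : Set where
  lin ind coi : Binder

binderLabel : Binder → Label
binderLabel lin = lam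
binderLabel ind = lam↓
binderLabel coi = lam↑

rename-binder : ∀ k ρ M →
  unary (binderLabel k) (rename (liftʳ ρ) M) ≈ rename ρ (unary (binderLabel k) M)
rename-binder lin ρ M = mk≈ λ { [] _ → refl ; (_ ∷ _) _ → refl }
rename-binder ind ρ M = mk≈ λ { [] _ → refl ; (_ ∷ _) _ → refl }
rename-binder coi ρ M = mk≈ λ { [] _ → refl ; (_ ∷ _) _ → refl }

substitute-binder : ∀ k σ M →
  unary (binderLabel k) (substitute (liftˢ σ) M) ≈ substitute σ (unary (binderLabel k) M)
substitute-binder lin σ M = mk≈ λ { [] _ → refl ; (_ ∷ _) _ → refl }
substitute-binder ind σ M = mk≈ λ { [] _ → refl ; (_ ∷ _) _ → refl }
substitute-binder coi σ M = mk≈ λ { [] _ → refl ; (_ ∷ _) _ → refl }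

-- Slots, permissions and weights

VarSet : Set
VarSet = ℕ → Bool

infix 4 _∈_
_∈_ : ℕ → VarSet → Set
y ∈ Φ = Φ y ≡ true

infixr 5 _∷ᵇ_
_∷ᵇ_ : Bool → VarSet → VarSet
(b ∷ᵇ Φ) zero    = b
(b ∷ᵇ Φ) (suc y) = Φ y

-- A record rather than a bare function type, so that the two sets can be inferred.
record Maps (ρ : ℕ → ℕ) (Φ Φ′ : VarSet) : Set where
  constructor maps
  field
    image : ∀ y → y ∈ Φ → ρ y ∈ Φ′
open Maps

maps-lift : ∀ b {ρ Φ Φ′} → Maps ρ Φ Φ′ → Maps (liftʳ ρ) (b ∷ᵇ Φ) (b ∷ᵇ Φ′)
maps-lift b h = maps λ { zero e → e ; (suc y) e → image h y e }

maps-suc : ∀ b {Φ} → Maps suc Φ (b ∷ᵇ Φ)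
maps-suc b = maps λ _ e → e

-- Whether the bound variable may occur outside, resp. inside, the ↑-boxes.
shallow deep : Binder → Bool
shallow lin = true
shallow ind = true
shallow coi = false
deep lin = false
deep ind = false
deep coi = true

-- The flags tell whether the variable is in scope outside, resp. inside, the ↑-boxes; a slot
-- demands the zones in which the typing rules let its variable occur.
Permit : Bool → Bool → Slot → Set
Permit b c nothing       = ⊤
Permit b c (just plain)  = b ≡ true
Permit b c (just hash)   = b ≡ true
Permit b c (just down)   = b ≡ true
Permit b c (just up)     = c ≡ true
Permit b c (just dagger) = b ≡ true × c ≡ true

permit-split : ∀ {b c s s₁ s₂} → SplitSlot s s₁ s₂ → Permit b c s → Permit b c s₁ × Permit b c s₂
permit-split (toˡ _)  p = p , tt
permit-split (toʳ _)  p = tt , p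
permit-split (both _) p = p , p

permit-box↓ : ∀ {b c s t} → Box↓Slot s t → Permit b c s → Permit b c t
permit-box↓ absent p = tt
permit-box↓ hash   p = tt
permit-box↓ down   p = p
permit-box↓ up     p = p
permit-box↓ dagger p = p

-- Inside a ↑-box all patterns are †, so a single flag governs both zones from there on.
permit-box↑ : ∀ {b c s t} → Box↑Slot s t → Permit b c s → Permit c c t
permit-box↑ absent p       = tt
permit-box↑ hash   p       = tt
permit-box↑ up     p       = p , p
permit-box↑ dagger (_ , p) = p , p

permit-∷ : ∀ {Ψ Φ : VarSet} {Γ b c} s → Permit b c s →
  (∀ y → Permit (Ψ y) (Φ y) (slot Γ y)) →
  ∀ y → Permit ((b ∷ᵇ Ψ) y) ((c ∷ᵇ Φ) y) (slot (s ∷ Γ) y)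
permit-∷ s p ps zero    = p
permit-∷ s p ps (suc y) = ps y

-- The weight f n of a variable, as a function of the base n, allowed by a slot.
Weight : Slot → (ℕ → ℕ) → Set
Weight nothing       f = ∀ n → f n ≡ 0
Weight (just plain)  f = ∀ n → f n ≡ 1
Weight (just down)   f = ∀ n → f n ≡ n
Weight (just up)     f = ∀ n → f n ≡ 0
Weight (just hash)   f = ∃[ k ] ∀ n → f n ≤ k
Weight (just dagger) f = ⊤

weight-split : ∀ {s s₁ s₂ f g} → SplitSlot s s₁ s₂ →
  Weight s₁ f → Weight s₂ g → Weight s (λ n → f n + g n)
weight-split (toˡ plain)   p q         = λ n → cong₂ _+_ (p n) (q n)
weight-split (toˡ down)    p q         = λ n → trans (cong₂ _+_ (p n) (q n)) (+-identityʳ n)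
weight-split (toʳ plain)   p q         = λ n → cong₂ _+_ (p n) (q n)
weight-split (toʳ down)    p q         = λ n → cong₂ _+_ (p n) (q n)
weight-split (both absent) p q         = λ n → cong₂ _+_ (p n) (q n)
weight-split (both hash) (k , p) (l , q) = k + l , λ n → +-mono-≤ (p n) (q n)
weight-split (both up)     p q         = λ n → cong₂ _+_ (p n) (q n)
weight-split (both dagger) p q         = tt

weight-box↓ : ∀ {s t f} → Box↓Slot s t → Weight t f → Weight s (λ n → n * f n)
weight-box↓ absent p = λ n → trans (cong (n *_) (p n)) (*-zeroʳ n)
weight-box↓ hash   p = 0 , λ n → ≤-reflexive (trans (cong (n *_) (p n)) (*-zeroʳ n))
weight-box↓ down   p = λ n → trans (cong (n *_) (p n)) (*-identityʳ n)
weight-box↓ up     p = λ n → trans (cong (n *_) (p n)) (*-zeroʳ n)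
weight-box↓ dagger p = tt

weight-box↑ : ∀ {s t} → Box↑Slot s t → Weight s (λ _ → 0)
weight-box↑ absent = λ _ → refl
weight-box↑ hash   = 0 , λ _ → z≤n
weight-box↑ up     = λ _ → refl
weight-box↑ dagger = tt

weight-shared : ∀ {s} → Shared s → Weight s (λ _ → 0)
weight-shared absent = λ _ → refl
weight-shared hash   = 0 , λ _ → z≤n
weight-shared up     = λ _ → refl
weight-shared dagger = tt

weight-axiom : ∀ {π Γ x} → Axiom π Γ x → Weight (just π) (λ _ → 1) →
  ∀ y → Weight (slot Γ y) (λ _ → δ x y)
weight-axiom (here h)    w zero    = w
weight-axiom (here h)    w (suc y) = weight-shared (slot-shared h y)
weight-axiom (there q t) w zero    = weight-shared q
weight-axiom (there q t) w (suc y) = weight-axiom t w y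

BinderWeight : ℕ → Binder → ℕ → Set
BinderWeight n lin m = m ≡ 1
BinderWeight n ind m = m ≤ n
BinderWeight n coi m = m ≡ 0

binderWeight-≼ : ∀ {n} k {m m′} → m′ ≼ m → BinderWeight n k m → BinderWeight n k m′
binderWeight-≼ lin (l , e) refl = e (s≤s z≤n)
binderWeight-≼ ind (l , e) w    = ≤-trans l w
binderWeight-≼ coi (l , e) refl = e z≤n

-- Skeletons, renaming and substitution

-- `X` is the post-fixed point that witnesses a typing. Working over it instead of `_⊢_` keeps
-- contents in `Set`, as is required of the relations that witness the coinductive conclusions.
module Normalisation (X : REL Env Preterm 0ℓ) (unfoldˣ : ∀ {Γ M} → X Γ M → Derivation X Γ M) where

  -- Contents of ↑-boxes whose free variables, all of them †, lie in Φ; the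
  -- closure of X under the operations that reduction performs on them.
  data Content (Φ : VarSet) : Preterm → Set where
    baseᶜ : ∀ {Γ L} → X Γ L → (∀ y → Permit (Φ y) (Φ y) (slot Γ y)) → Content Φ L
    varᶜ  : ∀ x → x ∈ Φ → Content Φ (` x)
    renᶜ  : ∀ {Φ₀ L} ρ → Content Φ₀ L → Maps ρ Φ₀ Φ → Content Φ (rename ρ L)
    subᶜ  : ∀ {Φ₀ L} σ → Content Φ₀ L → (∀ y → y ∈ Φ₀ → Content Φ (σ y)) →
            Content Φ (substitute σ L)

  -- The finite part of a term outside its ↑-boxes; free variables in Ψ may
  -- occur there, those in Φ inside the ↑-boxes.
  data Skeleton (Ψ Φ : VarSet) : Set where
    var  : ∀ x → x ∈ Ψ → Skeleton Ψ Φ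
    app  : Skeleton Ψ Φ → Skeleton Ψ Φ → Skeleton Ψ Φ
    bind : ∀ k → Skeleton (shallow k ∷ᵇ Ψ) (deep k ∷ᵇ Φ) → Skeleton Ψ Φ
    box↓ : Skeleton Ψ Φ → Skeleton Ψ Φ
    box↑ : ∀ L → Content Φ L → Skeleton Ψ Φ

  ⟦_⟧ : ∀ {Ψ Φ} → Skeleton Ψ Φ → Preterm
  ⟦ var x _ ⟧  = ` x
  ⟦ app S T ⟧  = ⟦ S ⟧ · ⟦ T ⟧
  ⟦ bind k S ⟧ = unary (binderLabel k) ⟦ S ⟧
  ⟦ box↓ S ⟧   = ↓ ⟦ S ⟧
  ⟦ box↑ L _ ⟧ = ↑ L

  wt : ∀ {Ψ Φ} → ℕ → Skeleton Ψ Φ → ℕ → ℕ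
  wt n (var x _)  z = δ x z
  wt n (app S T)  z = wt n S z + wt n T z
  wt n (bind k S) z = wt n S (suc z)
  wt n (box↓ S)   z = n * wt n S z
  wt n (box↑ _ _) z = 0

  -- The factor `n` at a ↓-box pays in advance for the copies that a λ↓-redex makes of the box's
  -- content.
  size : ∀ {Ψ Φ} → ℕ → Skeleton Ψ Φ → ℕ
  size n (var _ _)  = 1
  size n (app S T)  = suc (size n S + size n T)
  size n (bind k S) = suc (size n S)
  size n (box↓ S)   = n * size n S
  size n (box↑ _ _) = 1

  Good : ∀ {Ψ Φ} → ℕ → Skeleton Ψ Φ → Set
  Good n (var _ _)  = ⊤
  Good n (app S T)  = Good n S × Good n T
  Good n (bind k S) = BinderWeight n k (wt n S 0) × Good n S
  Good n (box↓ S)   = Good n S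
  Good n (box↑ _ _) = ⊤

  ren : ∀ {Ψ Φ Ψ′ Φ′} ρ → Maps ρ Ψ Ψ′ → Maps ρ Φ Φ′ →
        Skeleton Ψ Φ → Skeleton Ψ′ Φ′
  ren ρ f g (var x e)  = var (ρ x) (image f x e)
  ren ρ f g (app S T)  = app (ren ρ f g S) (ren ρ f g T)
  ren ρ f g (bind k S) = bind k (ren (liftʳ ρ) (maps-lift (shallow k) f) (maps-lift (deep k) g) S)
  ren ρ f g (box↓ S)   = box↓ (ren ρ f g S)
  ren ρ f g (box↑ L u) = box↑ (rename ρ L) (renᶜ ρ u g)

  ren-⟦⟧ : ∀ {Ψ Φ Ψ′ Φ′} ρ (f : Maps ρ Ψ Ψ′) (g : Maps ρ Φ Φ′) S →
           ⟦ ren ρ f g S ⟧ ≈ rename ρ ⟦ S ⟧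
  ren-⟦⟧ ρ f g (var x e)  = ≈-refl
  ren-⟦⟧ ρ f g (app S T)  = ≈-trans (·-cong (ren-⟦⟧ ρ f g S) (ren-⟦⟧ ρ f g T)) (rename-· ρ _ _)
  ren-⟦⟧ ρ f g (bind k S) = ≈-trans (unary-cong _ (ren-⟦⟧ _ _ _ S)) (rename-binder k ρ _)
  ren-⟦⟧ ρ f g (box↓ S)   =
    ≈-trans (unary-cong _ (ren-⟦⟧ ρ f g S)) (mk≈ λ { [] _ → refl ; (_ ∷ _) _ → refl })
  ren-⟦⟧ ρ f g (box↑ L u) = mk≈ λ { [] _ → refl ; (_ ∷ _) _ → refl }

  -- The factor `c` is 1 if `w` is the only preimage of `z` under `ρ`, and 0 if `z` has no preimage;
  -- one induction serves both cases.
  ren-wt : ∀ {Ψ Φ Ψ′ Φ′} n ρ (f : Maps ρ Ψ Ψ′) (g : Maps ρ Φ Φ′) S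
           z w c → (∀ y → δ (ρ y) z ≡ δ y w * c) → wt n (ren ρ f g S) z ≡ wt n S w * c
  ren-wt n ρ f g (var x _)  z w c h = h x
  ren-wt n ρ f g (app S T)  z w c h =
    trans (cong₂ _+_ (ren-wt n ρ f g S z w c h) (ren-wt n ρ f g T z w c h))
          (sym (*-distribʳ-+ c (wt n S w) (wt n T w)))
  ren-wt n ρ f g (bind k S) z w c h =
    ren-wt n _ _ _ S (suc z) (suc w) c λ { zero → refl ; (suc y) → h y }
  ren-wt n ρ f g (box↓ S)   z w c h =
    trans (cong (n *_) (ren-wt n ρ f g S z w c h)) (sym (*-assoc n (wt n S w) c))
  ren-wt n ρ f g (box↑ _ _) z w c h = refl

  ren-size : ∀ {Ψ Φ Ψ′ Φ′} n ρ (f : Maps ρ Ψ Ψ′) (g : Maps ρ Φ Φ′) S →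
             size n (ren ρ f g S) ≡ size n S
  ren-size n ρ f g (var x _)  = refl
  ren-size n ρ f g (app S T)  = cong suc (cong₂ _+_ (ren-size n ρ f g S) (ren-size n ρ f g T))
  ren-size n ρ f g (bind k S) = cong suc (ren-size n _ _ _ S)
  ren-size n ρ f g (box↓ S)   = cong (n *_) (ren-size n ρ f g S)
  ren-size n ρ f g (box↑ _ _) = refl

  ren-good : ∀ {Ψ Φ Ψ′ Φ′} n ρ (f : Maps ρ Ψ Ψ′) (g : Maps ρ Φ Φ′) S →
             Good n S → Good n (ren ρ f g S)
  ren-good n ρ f g (var x _)  G       = tt
  ren-good n ρ f g (app S T)  (G , H) = ren-good n ρ f g S G , ren-good n ρ f g T H
  ren-good n ρ f g (bind k S) (w , G) =
    subst (BinderWeight n k) (sym bound) w , ren-good n _ _ _ S G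
    where
    bound = trans (ren-wt n (liftʳ ρ) (maps-lift (shallow k) f) (maps-lift (deep k) g) S 0 0 1
                     λ { zero → refl ; (suc y) → refl })
                  (*-identityʳ (wt n S 0))
  ren-good n ρ f g (box↓ S)   G       = ren-good n ρ f g S G
  ren-good n ρ f g (box↑ _ _) G       = tt

  weaken : ∀ b c {Ψ Φ} → Skeleton Ψ Φ → Skeleton (b ∷ᵇ Ψ) (c ∷ᵇ Φ)
  weaken b c = ren suc (maps-suc b) (maps-suc c)

  weaken-wt-zero : ∀ b c {Ψ Φ} n (S : Skeleton Ψ Φ) → wt n (weaken b c S) 0 ≡ 0
  weaken-wt-zero b c n S =
    trans (ren-wt n suc _ _ S 0 0 0 λ y → sym (*-zeroʳ (δ y 0))) (*-zeroʳ (wt n S 0))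

  weaken-wt-suc : ∀ b c {Ψ Φ} n (S : Skeleton Ψ Φ) z → wt n (weaken b c S) (suc z) ≡ wt n S z
  weaken-wt-suc b c n S z =
    trans (ren-wt n suc _ _ S (suc z) z 1 λ y → sym (*-identityʳ (δ y z))) (*-identityʳ (wt n S z))

  Images : VarSet → VarSet → VarSet → Set
  Images Ψ Ψ′ Φ′ = ∀ y → y ∈ Ψ → Skeleton Ψ′ Φ′

  lift-images : ∀ b c {Ψ Ψ′ Φ′} → Images Ψ Ψ′ Φ′ → Images (b ∷ᵇ Ψ) (b ∷ᵇ Ψ′) (c ∷ᵇ Φ′)
  lift-images b c τ zero    e = var zero e
  lift-images b c τ (suc y) e = weaken b c (τ y e)

  lift-contents : ∀ c {Φ Φ′ σ} → (∀ y → y ∈ Φ → Content Φ′ (σ y)) →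
                  ∀ y → y ∈ c ∷ᵇ Φ → Content (c ∷ᵇ Φ′) (liftˢ σ y)
  lift-contents c ω zero    e = varᶜ zero e
  lift-contents c ω (suc y) e = renᶜ suc (ω y e) (maps-suc c)

  -- Outside the ↑-boxes variables are replaced by the skeletons `τ`. Contents of ↑-boxes are not
  -- traversed: the substitution `σ` is recorded formally by `subᶜ`, so the recursion stays on the
  -- finite skeleton.
  sub : ∀ {Ψ Φ Ψ′ Φ′} σ → Images Ψ Ψ′ Φ′ → (∀ y → y ∈ Φ → Content Φ′ (σ y)) →
        Skeleton Ψ Φ → Skeleton Ψ′ Φ′
  sub σ τ ω (var x e)  = τ x e
  sub σ τ ω (app S T)  = app (sub σ τ ω S) (sub σ τ ω T)
  sub σ τ ω (bind k S) =
    bind k (sub (liftˢ σ) (lift-images (shallow k) (deep k) τ) (lift-contents (deep k) ω) S)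
  sub σ τ ω (box↓ S)   = box↓ (sub σ τ ω S)
  sub σ τ ω (box↑ L u) = box↑ (substitute σ L) (subᶜ σ u ω)

  sub-⟦⟧ : ∀ {Ψ Φ Ψ′ Φ′} σ (τ : Images Ψ Ψ′ Φ′) (ω : ∀ y → y ∈ Φ → Content Φ′ (σ y)) S →
           (∀ y e → ⟦ τ y e ⟧ ≈ σ y) → ⟦ sub σ τ ω S ⟧ ≈ substitute σ ⟦ S ⟧
  sub-⟦⟧ σ τ ω (var x e)  h = h x e
  sub-⟦⟧ σ τ ω (app S T)  h =
    ≈-trans (·-cong (sub-⟦⟧ σ τ ω S h) (sub-⟦⟧ σ τ ω T h)) (substitute-· σ _ _)
  sub-⟦⟧ σ τ ω (bind k S) h =
    ≈-trans (unary-cong _ (sub-⟦⟧ _ _ _ S λ where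
              zero    e → ≈-refl
              (suc y) e → ≈-trans (ren-⟦⟧ suc _ _ (τ y e)) (rename-cong suc (h y e))))
            (substitute-binder k σ _)
  sub-⟦⟧ σ τ ω (box↓ S)   h =
    ≈-trans (unary-cong _ (sub-⟦⟧ σ τ ω S h)) (mk≈ λ { [] _ → refl ; (_ ∷ _) _ → refl })
  sub-⟦⟧ σ τ ω (box↑ L u) h = mk≈ λ { [] _ → refl ; (_ ∷ _) _ → refl }

  -- In a contraction, `v` is the former index of `z`, `w` is the replaced variable, and `c` is the
  -- weight of `z` in the argument.
  sub-wt : ∀ {Ψ Φ Ψ′ Φ′} n σ (τ : Images Ψ Ψ′ Φ′) (ω : ∀ y → y ∈ Φ → Content Φ′ (σ y)) S
           z v w c → (∀ y e → wt n (τ y e) z ≡ δ y v + δ y w * c) →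
           wt n (sub σ τ ω S) z ≡ wt n S v + wt n S w * c
  sub-wt n σ τ ω (var x e)  z v w c h = h x e
  sub-wt n σ τ ω (app S T)  z v w c h =
    trans (cong₂ _+_ (sub-wt n σ τ ω S z v w c h) (sub-wt n σ τ ω T z v w c h))
          (sum-linear (wt n S v) (wt n S w) (wt n T v) (wt n T w) c)
  sub-wt n σ τ ω (bind k S) z v w c h =
    sub-wt n _ _ _ S (suc z) (suc v) (suc w) c λ where
      zero    e → refl
      (suc y) e → trans (weaken-wt-suc _ _ n (τ y e) z) (h y e)
  sub-wt n σ τ ω (box↓ S)   z v w c h =
    trans (cong (n *_) (sub-wt n σ τ ω S z v w c h)) (scale-linear n (wt n S v) (wt n S w) c)
  sub-wt n σ τ ω (box↑ _ _) z v w c h = refl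

  sub-size : ∀ {Ψ Φ Ψ′ Φ′} n σ (τ : Images Ψ Ψ′ Φ′) (ω : ∀ y → y ∈ Φ → Content Φ′ (σ y)) S
             w c → (∀ y e → size n (τ y e) ≤ 1 + δ y w * c) →
             size n (sub σ τ ω S) ≤ size n S + wt n S w * c
  sub-size n σ τ ω (var x e)  w c h = h x e
  sub-size n σ τ ω (app S T)  w c h =
    s≤s (≤-trans (+-mono-≤ (sub-size n σ τ ω S w c h) (sub-size n σ τ ω T w c h))
                 (≤-reflexive (sum-linear (size n S) (wt n S w) (size n T) (wt n T w) c)))
  sub-size n σ τ ω (bind k S) w c h =
    s≤s (sub-size n _ _ _ S (suc w) c λ where
      zero    e → ≤-refl
      (suc y) e → ≤-trans (≤-reflexive (ren-size n suc _ _ (τ y e))) (h y e))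
  sub-size n σ τ ω (box↓ S)   w c h =
    ≤-trans (*-monoʳ-≤ n (sub-size n σ τ ω S w c h))
            (≤-reflexive (scale-linear n (size n S) (wt n S w) c))
  sub-size n σ τ ω (box↑ _ _) w c h = ≤-refl

  Bounds : VarSet → Set
  Bounds Ψ = ∀ y → y ∈ Ψ → ℕ

  lift-bounds : ∀ b {Ψ} → Bounds Ψ → Bounds (b ∷ᵇ Ψ)
  -- The newly bound variable is its own image, which is `Good` for every `n`.
  lift-bounds b f zero    e = 0
  lift-bounds b f (suc y) e = f y e

  maximum : ∀ {Ψ Φ} → Bounds Ψ → Skeleton Ψ Φ → ℕ
  maximum f (var x e)  = f x e
  maximum f (app S T)  = maximum f S ⊔ maximum f T
  maximum f (bind k S) = maximum (lift-bounds (shallow k) f) S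
  maximum f (box↓ S)   = maximum f S
  maximum f (box↑ _ _) = 0

  maximum-≤ : ∀ {Ψ Φ} (f : Bounds Ψ) n (S : Skeleton Ψ Φ) → (∀ y e → f y e ≤ n) → maximum f S ≤ n
  maximum-≤ f n (var x e)  h = h x e
  maximum-≤ f n (app S T)  h = ⊔-lub (maximum-≤ f n S h) (maximum-≤ f n T h)
  maximum-≤ f n (bind k S) h = maximum-≤ _ n S λ { zero e → z≤n ; (suc y) e → h y e }
  maximum-≤ f n (box↓ S)   h = maximum-≤ f n S h
  maximum-≤ f n (box↑ _ _) h = z≤n

  -- Infinitely many images may need unboundedly large n, but only those at
  -- the finitely many occurrences in S matter.
  sub-good : ∀ {Ψ Φ Ψ′ Φ′} n σ (τ : Images Ψ Ψ′ Φ′) (ω : ∀ y → y ∈ Φ → Content Φ′ (σ y)) f S →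
             (∀ y e → f y e ≤ n → Good n (τ y e)) → maximum f S ≤ n →
             Good n S → Good n (sub σ τ ω S)
  sub-good n σ τ ω f (var x e)  h m G       = h x e m
  sub-good n σ τ ω f (app S T)  h m (G , H) =
    sub-good n σ τ ω f S h (m⊔n≤o⇒m≤o _ _ m) G ,
    sub-good n σ τ ω f T h (m⊔n≤o⇒n≤o (maximum f S) _ m) H
  sub-good n σ τ ω f (bind k S) h m (w , G) =
    subst (BinderWeight n k) (sym bound) w ,
    sub-good n _ _ _ (lift-bounds (shallow k) f) S
      (λ { zero e _ → tt ; (suc y) e l → ren-good n suc _ _ (τ y e) (h y e l) }) m G
    where
    bound = trans
      (sub-wt n (liftˢ σ) (lift-images (shallow k) (deep k) τ) (lift-contents (deep k) ω) S 0 0 0 0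
        λ { zero    e → refl
          ; (suc y) e → weaken-wt-zero (shallow k) (deep k) n (τ y e) })
      (trans (cong (wt n S 0 +_) (*-zeroʳ (wt n S 0))) (+-identityʳ (wt n S 0)))
  sub-good n σ τ ω f (box↓ S)   h m G       = sub-good n σ τ ω f S h m G
  sub-good n σ τ ω f (box↑ _ _) h m G       = tt

  -- Skeletons of derivable terms

  -- `Good` holds for all large `n` rather than for one, so that skeletons can be combined over a
  -- common base.
  record Encoding (Ψ Φ : VarSet) (M : Preterm) : Set where
    constructor encoding
    field
      skeleton  : Skeleton Ψ Φ
      unfolds   : M ≈ ⟦ skeleton ⟧
      threshold : ℕ
      good      : ∀ n → threshold ≤ n → Good n skeleton
  open Encoding

  -- Induction on the part of the derivation before the rule mc. The weights are carried as
  -- functions of `n` so that, when a binder closes slot 0, they give its `BinderWeight`.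
  encode : ∀ {Γ M} → Derivation X Γ M → ∀ Ψ Φ → (∀ y → Permit (Ψ y) (Φ y) (slot Γ y)) →
           Σ[ E ∈ Encoding Ψ Φ M ] (∀ y → Weight (slot Γ y) (λ n → wt n (skeleton E) y))
  encode (vl {x} e t) Ψ Φ p =
    encoding (var x (subst (Permit (Ψ x) (Φ x)) (slot-axiom t) (p x))) e 0 (λ _ _ → tt) ,
    weight-axiom t (λ _ → refl)
  encode (vd {x} e t) Ψ Φ p =
    encoding (var x (subst (Permit (Ψ x) (Φ x)) (slot-axiom t) (p x))) e 0 (λ _ _ → tt) ,
    weight-axiom t (1 , λ _ → ≤-refl)
  encode (va {x} e t) Ψ Φ p =
    encoding (var x (proj₁ (subst (Permit (Ψ x) (Φ x)) (slot-axiom t) (p x)))) e 0 (λ _ _ → tt) ,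
    weight-axiom t tt
  encode (a e t d₁ d₂) Ψ Φ p
    with encoding S e₁ n₁ G , v ← encode d₁ Ψ Φ (λ y → proj₁ (permit-split (slot-split t y) (p y)))
       | encoding T e₂ n₂ H , w ← encode d₂ Ψ Φ (λ y → proj₂ (permit-split (slot-split t y) (p y)))
    = encoding (app S T) (≈-trans e (·-cong e₁ e₂)) (n₁ ⊔ n₂)
        (λ n l → G n (m⊔n≤o⇒m≤o n₁ n₂ l) , H n (m⊔n≤o⇒n≤o n₁ n₂ l)) ,
      λ y → weight-split (slot-split t y) (v y) (w y)
  encode (ll e d) Ψ Φ p
    with encoding S e₁ n₁ G , w ← encode d (true ∷ᵇ Ψ) (false ∷ᵇ Φ) (permit-∷ (just plain) refl p)
    = encoding (bind lin S) (≈-trans e (unary-cong _ e₁)) n₁ (λ n l → w 0 n , G n l) , w ∘ suc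
  encode (li₁ e d) Ψ Φ p
    with encoding S e₁ n₁ G , w ← encode d (true ∷ᵇ Ψ) (false ∷ᵇ Φ) (permit-∷ (just hash) refl p)
    -- The bound `k` on a # variable does not depend on `n`; raising the threshold to `k` brings the
    -- weight below `n`.
    with k , b ← w 0
    = encoding (bind ind S) (≈-trans e (unary-cong _ e₁)) (n₁ ⊔ k)
        (λ n l → ≤-trans (b n) (m⊔n≤o⇒n≤o n₁ k l) , G n (m⊔n≤o⇒m≤o n₁ k l)) ,
      w ∘ suc
  encode (li₂ e d) Ψ Φ p
    with encoding S e₁ n₁ G , w ← encode d (true ∷ᵇ Ψ) (false ∷ᵇ Φ) (permit-∷ (just down) refl p)
    = encoding (bind ind S) (≈-trans e (unary-cong _ e₁)) n₁
        (λ n l → ≤-reflexive (w 0 n) , G n l) , w ∘ suc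
  encode (lc e d) Ψ Φ p
    with encoding S e₁ n₁ G , w ← encode d (false ∷ᵇ Ψ) (true ∷ᵇ Φ) (permit-∷ (just up) refl p)
    = encoding (bind coi S) (≈-trans e (unary-cong _ e₁)) n₁ (λ n l → w 0 n , G n l) , w ∘ suc
  encode (mi e t d) Ψ Φ p
    with encoding S e₁ n₁ G , w ← encode d Ψ Φ (λ y → permit-box↓ (slot-pointwise absent t y) (p y))
    = encoding (box↓ S) (≈-trans e (unary-cong _ e₁)) n₁ G ,
      λ y → weight-box↓ (slot-pointwise absent t y) (w y)
  encode (mc {L} e t x) Ψ Φ p =
    encoding (box↑ L (baseᶜ x λ y → permit-box↑ (slot-pointwise absent t y) (p y))) e 0
      (λ _ _ → tt) ,
    λ y → weight-box↑ (slot-pointwise absent t y)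

  -- Structural recursion on the closure operations; at `baseᶜ`, one unfolding of the coinductive
  -- premise exposes a finite derivation, which is encoded.
  unfold : ∀ {Φ L} → Content Φ L → Encoding Φ Φ L
  unfold {Φ} (baseᶜ x p) = proj₁ (encode (unfoldˣ x) Φ Φ p)
  unfold (varᶜ x e) = encoding (var x e) ≈-refl 0 (λ _ _ → tt)
  unfold (renᶜ ρ u h) with encoding S e n₀ G ← unfold u =
    encoding (ren ρ h h S) (≈-trans (rename-cong ρ e) (≈-sym (ren-⟦⟧ ρ h h S))) n₀
      (λ n l → ren-good n ρ h h S (G n l))
  unfold {Φ} (subᶜ {Φ₀} σ u ω) with encoding S e n₀ G ← unfold u =
    encoding (sub σ τ ω S)
      (≈-trans (substitute-cong σ e)
               (≈-sym (sub-⟦⟧ σ τ ω S λ y i → ≈-sym (unfolds (images y i)))))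
      (n₀ ⊔ maximum f S)
      λ n l → sub-good n σ τ ω f S (λ y i → good (images y i) n)
                (m⊔n≤o⇒n≤o n₀ _ l) (G n (m⊔n≤o⇒m≤o n₀ _ l))
    where
    images : ∀ y → y ∈ Φ₀ → Encoding Φ Φ (σ y)
    images y i = unfold (ω y i)
    τ : Images Φ₀ Φ Φ
    τ y i = skeleton (images y i)
    f : Bounds Φ₀
    f y i = threshold (images y i)

  -- Reduction outside the ↑-boxes

  infix 4 _⟿_

  -- The clause on weights serves the enclosing binders: by `≼`, a bound variable of weight 1 or 0
  -- keeps it exactly, and one of weight at most `n` stays below `n`.
  record _⟿_ {Ψ Φ} (S S′ : Skeleton Ψ Φ) : Set where
    constructor mk⟿
    field
      ⟶⟦⟧    : ⟦ S ⟧ ⟶ ⟦ S′ ⟧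
      measure : ∀ n → 2 ≤ n → Good n S →
                Good n S′ × size n S′ < size n S × (∀ z → wt n S′ z ≼ wt n S z)

  instantiate : ∀ {Ψ Φ} b → Skeleton Ψ Φ → Images (b ∷ᵇ Ψ) Ψ Φ
  instantiate b T zero    e = T
  instantiate b T (suc y) e = var y e

  instantiate-wt : ∀ {Ψ Φ} b n (T : Skeleton Ψ Φ) z y e →
    wt n (instantiate {Ψ} b T y e) z ≡ δ y (suc z) + δ y 0 * wt n T z
  instantiate-wt b n T z zero    e = sym (+-identityʳ (wt n T z))
  instantiate-wt b n T z (suc y) e = sym (+-identityʳ (δ y z))

  instantiate-size : ∀ {Ψ Φ} b n (T : Skeleton Ψ Φ) y e →
    size n (instantiate {Ψ} b T y e) ≤ 1 + δ y 0 * size n T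
  instantiate-size b n T zero    e = ≤-trans (n≤1+n _) (s≤s (≤-reflexive (sym (+-identityʳ _))))
  instantiate-size b n T (suc y) e = ≤-refl

  instantiate-good : ∀ {Ψ Φ} b n (T : Skeleton Ψ Φ) → Good n T →
    ∀ y e → Good n (instantiate {Ψ} b T y e)
  instantiate-good b n T G zero    e = G
  instantiate-good b n T G (suc y) e = tt

  instantiate-⟦⟧ : ∀ {Ψ Φ} b (T : Skeleton Ψ Φ) y e → ⟦ instantiate {Ψ} b T y e ⟧ ≈ single ⟦ T ⟧ y
  instantiate-⟦⟧ b T zero    e = ≈-refl
  instantiate-⟦⟧ b T (suc y) e = ≈-refl

  -- A variable bound by λ or λ↓ never occurs inside a ↑-box, so the argument `N` need not be a
  -- content.
  variables : ∀ {Φ} N y → y ∈ false ∷ᵇ Φ → Content Φ (single N y)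
  variables N (suc y) e = varᶜ y e

  infix 10 _[_]ˢ
  _[_]ˢ : ∀ {Ψ Φ} → Skeleton (true ∷ᵇ Ψ) (false ∷ᵇ Φ) → Skeleton Ψ Φ → Skeleton Ψ Φ
  S [ T ]ˢ = sub (single ⟦ T ⟧) (instantiate true T) (variables ⟦ T ⟧) S

  module _ {Ψ Φ} (S : Skeleton (true ∷ᵇ Ψ) (false ∷ᵇ Φ)) (T : Skeleton Ψ Φ) where

    []ˢ-⟦⟧ : ⟦ S [ T ]ˢ ⟧ ≈ ⟦ S ⟧ [ ⟦ T ⟧ ]
    []ˢ-⟦⟧ = sub-⟦⟧ _ _ _ S (instantiate-⟦⟧ true T)

    []ˢ-wt : ∀ n z → wt n (S [ T ]ˢ) z ≡ wt n S (suc z) + wt n S 0 * wt n T z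
    []ˢ-wt n z = sub-wt n _ _ _ S z (suc z) 0 (wt n T z) (instantiate-wt true n T z)

    []ˢ-size : ∀ n → size n (S [ T ]ˢ) ≤ size n S + wt n S 0 * size n T
    []ˢ-size n = sub-size n _ _ _ S 0 (size n T) (instantiate-size true n T)

    []ˢ-good : ∀ n → Good n S → Good n T → Good n (S [ T ]ˢ)
    []ˢ-good n G H =
      sub-good n _ _ _ (λ _ _ → 0) S (λ y e _ → instantiate-good true n T H y e)
        (maximum-≤ _ n S λ _ _ → z≤n) G

    contract : app (bind lin S) T ⟿ S [ T ]ˢ
    contract = mk⟿ (step □ ≈-refl []ˢ-⟦⟧ (β _ _)) λ n _ ((w , G) , H) →
      []ˢ-good n G H ,
      s≤s (≤-trans ([]ˢ-size n) (≤-trans (≤-reflexive (once n w _)) (n≤1+n _))) ,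
      λ z → ≼-reflexive (trans ([]ˢ-wt n z) (once n w _))
      where
      once : ∀ n → wt n S 0 ≡ 1 → ∀ {m} k → m + wt n S 0 * k ≡ m + k
      once n w {m} k = cong (m +_) (trans (cong (_* k) w) (*-identityˡ k))

    -- The argument counted `n` times in its box and afterwards counts as often as the weight of the
    -- bound variable, at most `n`; the nodes of the redex are gained.
    contract↓ : app (bind ind S) (box↓ T) ⟿ S [ T ]ˢ
    contract↓ = mk⟿ (step □ ≈-refl []ˢ-⟦⟧ (β↓ _ _)) λ n h ((w , G) , H) →
      []ˢ-good n G H ,
      s≤s (≤-trans ([]ˢ-size n)
            (≤-trans (+-monoʳ-≤ (size n S) (*-monoˡ-≤ (size n T) w)) (n≤1+n _))) ,
      λ z → subst (_≼ wt n S (suc z) + n * wt n T z) (sym ([]ˢ-wt n z))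
              (≼-opening (wt n S (suc z)) (wt n T z) h w)

  module _ {Ψ Φ} (S : Skeleton (false ∷ᵇ Ψ) (true ∷ᵇ Φ)) {L} (u : Content Φ L) where

    images↑ : Images (false ∷ᵇ Ψ) Ψ Φ
    images↑ (suc y) e = var y e

    contents↑ : ∀ y → y ∈ true ∷ᵇ Φ → Content Φ (single L y)
    contents↑ zero    e = u
    contents↑ (suc y) e = varᶜ y e

    -- Outside the ↑-boxes the bound variable is absent and the substitution merely renames. Weights
    -- are thus unchanged and the size drops, however many copies of `L` enter other ↑-boxes.
    contract↑ : app (bind coi S) (box↑ L u) ⟿ sub (single L) images↑ contents↑ S
    contract↑ =
      mk⟿ (step □ ≈-refl (sub-⟦⟧ _ images↑ _ S λ { (suc y) e → ≈-refl }) (β↑ _ _))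
      λ n _ ((w , G) , _) →
        sub-good n _ images↑ _ (λ _ _ → 0) S (λ { (suc y) e _ → tt })
          (maximum-≤ _ n S λ _ _ → z≤n) G ,
        s≤s (≤-trans (sub-size n _ images↑ _ S 0 0 λ { (suc y) e → ≤-refl })
              (≤-trans (≤-reflexive (vanish n)) (≤-trans (+-monoʳ-≤ (size n S) z≤n) (n≤1+n _)))) ,
        λ z → ≼-reflexive (trans
          (sub-wt n _ images↑ _ S z (suc z) 0 0 λ { (suc y) e → sym (+-identityʳ (δ y z)) })
          (vanish n))
      where
      vanish : ∀ n {m} → m + wt n S 0 * 0 ≡ m + 0
      vanish n {m} = cong (m +_) (*-zeroʳ (wt n S 0))

  ⟿-appˡ : ∀ {Ψ Φ} {S S′ : Skeleton Ψ Φ} T → S ⟿ S′ → app S T ⟿ app S′ T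
  ⟿-appˡ T (mk⟿ (step C e₁ e₂ r) m) =
    mk⟿ (step (C ·ˡ ⟦ T ⟧) (·-cong e₁ ≈-refl) (·-cong e₂ ≈-refl) r) λ n h (G , H) →
      let G′ , l , w = m n h G in
      (G′ , H) , s≤s (+-monoˡ-≤ (size n T) l) , λ z → ≼-+ˡ (wt n T z) (w z)

  ⟿-appʳ : ∀ {Ψ Φ} (S : Skeleton Ψ Φ) {T T′} → T ⟿ T′ → app S T ⟿ app S T′
  ⟿-appʳ S {T} {T′} (mk⟿ (step C e₁ e₂ r) m) =
    mk⟿ (step (⟦ S ⟧ ·ʳ C) (·-cong ≈-refl e₁) (·-cong ≈-refl e₂) r) λ n h (G , H) →
      let H′ , l , w = m n h H in
      (G , H′) , s≤s (+-monoʳ-< (size n S) l) , λ z → ≼-+ʳ (wt n S z) (w z)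

  ⟿-bind : ∀ {Ψ Φ} k {S S′} → S ⟿ S′ → bind {Ψ} {Φ} k S ⟿ bind k S′
  ⟿-bind k {S} {S′} (mk⟿ (step C {L} {P} e₁ e₂ r) m) =
    mk⟿ (under k) λ n h (b , G) →
      let G′ , l , w = m n h G in
      (binderWeight-≼ k (w 0) b , G′) , s≤s l , λ z → w (suc z)
    where
    under : ∀ k → unary (binderLabel k) ⟦ S ⟧ ⟶ unary (binderLabel k) ⟦ S′ ⟧
    under lin = step (lam C) (unary-cong _ e₁) (unary-cong _ e₂) r
    under ind = step (lam↓ C) (unary-cong _ e₁) (unary-cong _ e₂) r
    under coi = step (lam↑ C) (unary-cong _ e₁) (unary-cong _ e₂) r

  ⟿-box↓ : ∀ {Ψ Φ} {S S′ : Skeleton Ψ Φ} → S ⟿ S′ → box↓ S ⟿ box↓ S′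
  ⟿-box↓ (mk⟿ (step C e₁ e₂ r) m) =
    mk⟿ (step (box↓ C) (unary-cong _ e₁) (unary-cong _ e₂) r) λ where
      (suc n) h G →
        let G′ , l , w = m (suc n) h G in
        G′ , *-monoʳ-< (suc n) l , λ z → ≼-* h (w z)

  -- Normal skeletons and their computation

  root : ∀ {Ψ Φ} → Skeleton Ψ Φ → Label
  root S = ⟦ S ⟧ []

  Normal : ∀ {Ψ Φ} → Skeleton Ψ Φ → Set
  Normal (var _ _)  = ⊤
  Normal (app S T)  = topRedex app (root S) (root T) ≡ false × Normal S × Normal T
  Normal (bind _ S) = Normal S
  Normal (box↓ S)   = Normal S
  Normal (box↑ _ _) = ⊤

  contract? : ∀ {Ψ Φ} (S T : Skeleton Ψ Φ) →
              topRedex app (root S) (root T) ≡ false ⊎ (∃[ S′ ] app S T ⟿ S′)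
  contract? (bind lin S) T            = inj₂ (_ , contract S T)
  contract? (bind ind S) (box↓ T)     = inj₂ (_ , contract↓ S T)
  contract? (bind coi S) (box↑ _ u)   = inj₂ (_ , contract↑ S u)
  contract? (var _ _)    T            = inj₁ refl
  contract? (app _ _)    T            = inj₁ refl
  contract? (box↓ _)     T            = inj₁ refl
  contract? (box↑ _ _)   T            = inj₁ refl
  contract? (bind ind _) (var _ _)    = inj₁ refl
  contract? (bind ind _) (app _ _)    = inj₁ refl
  contract? (bind ind _) (bind lin _) = inj₁ refl
  contract? (bind ind _) (bind ind _) = inj₁ refl
  contract? (bind ind _) (bind coi _) = inj₁ refl
  contract? (bind ind _) (box↑ _ _)   = inj₁ refl
  contract? (bind coi _) (var _ _)    = inj₁ refl
  contract? (bind coi _) (app _ _)    = inj₁ refl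
  contract? (bind coi _) (bind lin _) = inj₁ refl
  contract? (bind coi _) (bind ind _) = inj₁ refl
  contract? (bind coi _) (bind coi _) = inj₁ refl
  contract? (bind coi _) (box↓ _)     = inj₁ refl

  progress : ∀ {Ψ Φ} (S : Skeleton Ψ Φ) → Normal S ⊎ (∃[ S′ ] S ⟿ S′)
  progress (var _ _) = inj₁ tt
  progress (app S T) with contract? S T | progress S | progress T
  ... | inj₂ r       | _            | _            = inj₂ r
  ... | inj₁ _       | inj₂ (_ , r) | _            = inj₂ (_ , ⟿-appˡ T r)
  ... | inj₁ _       | inj₁ _       | inj₂ (_ , r) = inj₂ (_ , ⟿-appʳ S r)
  ... | inj₁ x       | inj₁ y       | inj₁ z       = inj₁ (x , y , z)
  progress (bind k S) with progress S
  ... | inj₁ x       = inj₁ x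
  ... | inj₂ (_ , r) = inj₂ (_ , ⟿-bind k r)
  progress (box↓ S) with progress S
  ... | inj₁ x       = inj₁ x
  ... | inj₂ (_ , r) = inj₂ (_ , ⟿-box↓ r)
  progress (box↑ _ _) = inj₁ tt

  -- The endpoint `result` is kept apart from the tree of `S`: an empty reduction ends in `M`
  -- itself, which agrees with that tree only up to `≈`.
  record NormalisesTo {Ψ Φ} (n : ℕ) (M : Preterm) (S : Skeleton Ψ Φ) : Set where
    constructor normalisesTo
    field
      {result} : Preterm
      ⟶*result : M ⟶* result
      result≈  : result ≈ ⟦ S ⟧
      normal   : Normal S
      goodⁿ    : Good n S
  open NormalisesTo

  -- The base `n` stays fixed along the reduction; `k` is a strict bound on the size, by which the
  -- recursion terminates.
  normalise : ∀ {Ψ Φ M} n → 2 ≤ n → ∀ k (S : Skeleton Ψ Φ) → size n S < k → M ≈ ⟦ S ⟧ → Good n S →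
              ∃[ S′ ] NormalisesTo {Ψ} {Φ} n M S′
  normalise n h (suc k) S l e G with progress S
  ... | inj₁ x = S , normalisesTo ε e x G
  ... | inj₂ (S₁ , mk⟿ r m)
    with G₁ , l₁ , _ ← m n h G
    with S′ , normalisesTo rs e′ x G′ ← normalise n h k S₁ (≤-trans l₁ (s≤s⁻¹ l)) ≈-refl G₁
    = S′ , normalisesTo (⟶-≈ˡ e r ◅ rs) e′ x G′

  -- Normal forms of contents, corecursively through the ↑-boxes

  base : ∀ {Φ L} → Content Φ L → ℕ
  base u = 2 ⊔ threshold (unfold u)

  2≤base : ∀ {Φ L} (u : Content Φ L) → 2 ≤ base u
  2≤base u = m≤m⊔n 2 (threshold (unfold u))

  normaliseᶜ : ∀ {Φ L} (u : Content Φ L) → ∃[ S ] NormalisesTo {Φ} {Φ} (base u) L S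
  normaliseᶜ u =
    normalise (base u) (2≤base u) _ (skeleton (unfold u)) ≤-refl (unfolds (unfold u))
      (good (unfold u) (base u) (m≤n⊔m 2 _))

  nfSkeleton : ∀ {Φ L} → Content Φ L → Skeleton Φ Φ
  nfSkeleton u = proj₁ (normaliseᶜ u)

  -- The tree of a skeleton, with the contents of its ↑-boxes normalised.
  tree : ∀ {Ψ Φ} → Skeleton Ψ Φ → Preterm
  tree (var x _)  _           = var x
  tree (app S T)  []          = app
  tree (app S T)  (left ∷ p)  = tree S p
  tree (app S T)  (right ∷ p) = tree T p
  tree (bind k S) []          = binderLabel k
  tree (bind k S) (_ ∷ p)     = tree S p
  tree (box↓ S)   []          = box↓
  tree (box↓ S)   (_ ∷ p)     = tree S p
  tree (box↑ _ u) []          = box↑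
  tree (box↑ _ u) (_ ∷ p)     = tree (nfSkeleton u) p

  nf : ∀ {Φ L} → Content Φ L → Preterm
  nf u = tree (nfSkeleton u)

  tree-app : ∀ {Ψ Φ} (S T : Skeleton Ψ Φ) → tree (app S T) ≈ tree S · tree T
  tree-app S T = mk≈ λ { [] _ → refl ; (left ∷ _) _ → refl ; (right ∷ _) _ → refl }

  tree-bind : ∀ {Ψ Φ} k S → tree (bind {Ψ} {Φ} k S) ≈ unary (binderLabel k) (tree S)
  tree-bind k S = mk≈ λ { [] _ → refl ; (_ ∷ _) _ → refl }

  tree-box↓ : ∀ {Ψ Φ} (S : Skeleton Ψ Φ) → tree (box↓ S) ≈ ↓ tree S
  tree-box↓ S = mk≈ λ { [] _ → refl ; (_ ∷ _) _ → refl }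

  tree-box↑ : ∀ {Ψ Φ L} (u : Content Φ L) → tree (box↑ {Ψ} L u) ≈ ↑ nf u
  tree-box↑ u = mk≈ λ { [] _ → refl ; (_ ∷ _) _ → refl }

  tree-root : ∀ {Ψ Φ} (S : Skeleton Ψ Φ) → root S ≡ tree S []
  tree-root (var _ _)  = refl
  tree-root (app _ _)  = refl
  tree-root (bind _ _) = refl
  tree-root (box↓ _)   = refl
  tree-root (box↑ _ _) = refl

  topRedex-binder : ∀ k l r → topRedex (binderLabel k) l r ≡ false
  topRedex-binder lin l r = refl
  topRedex-binder ind l r = refl
  topRedex-binder coi l r = refl

  -- The recursion is on the position: entering a ↑-box replaces the skeleton by a new one but
  -- shortens the path. At an application, `tree` has the same root labels as the skeleton, so
  -- `Normal` applies.
  tree-redex-free : ∀ {Ψ Φ} (S : Skeleton Ψ Φ) → Normal S →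
                    ∀ p → IsPosition (tree S) p → redexAt (tree S) p ≡ false
  tree-redex-free (var _ _)  _ []          _       = refl
  tree-redex-free (app S T)  (x , _) []    _       =
    trans (cong₂ (topRedex app) (sym (tree-root S)) (sym (tree-root T))) x
  tree-redex-free (app S T)  (_ , y , _) (left ∷ p)  (_ , i) = tree-redex-free S y p i
  tree-redex-free (app S T)  (_ , _ , z) (right ∷ p) (_ , i) = tree-redex-free T z p i
  tree-redex-free (bind k S) x []          _       = topRedex-binder k _ _
  tree-redex-free (bind k S) x (_ ∷ p)     (_ , i) = tree-redex-free S x p i
  tree-redex-free (box↓ S)   x []          _       = refl
  tree-redex-free (box↓ S)   x (_ ∷ p)     (_ , i) = tree-redex-free S x p i
  tree-redex-free (box↑ _ u) x []          _       = refl
  tree-redex-free (box↑ _ u) x (_ ∷ p)     (_ , i) =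
    tree-redex-free (nfSkeleton u) (normal (proj₂ (normaliseᶜ u))) p i

  nf-normal : ∀ {Φ L} (u : Content Φ L) → NormalForm (nf u)
  nf-normal u =
    redex-free⇒normal (tree-redex-free (nfSkeleton u) (normal (proj₂ (normaliseᶜ u))))

  -- The post-fixed point behind `⇒nf`; it is closed because the ↑-boxes of a normalised skeleton
  -- again hold contents.
  data ReducesToNf : Preterm → Preterm → Set where
    toNf : ∀ {Φ L} (u : Content Φ L) → ReducesToNf L (nf u)

  tree-inside : ∀ {Ψ Φ} (S : Skeleton Ψ Φ) {M} → M ≈ ⟦ S ⟧ → Inside ReducesToNf M (tree S)
  tree-inside (var x _)    e = var e ≈-refl
  tree-inside (app S T)    e = app e (tree-app S T) (tree-inside S ≈-refl) (tree-inside T ≈-refl)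
  tree-inside (bind lin S) e = lam e (tree-bind lin S) (tree-inside S ≈-refl)
  tree-inside (bind ind S) e = lam↓ e (tree-bind ind S) (tree-inside S ≈-refl)
  tree-inside (bind coi S) e = lam↑ e (tree-bind coi S) (tree-inside S ≈-refl)
  tree-inside (box↓ S)     e = box↓ e (tree-box↓ S) (tree-inside S ≈-refl)
  tree-inside {Ψ} (box↑ _ u) e = box↑ e (tree-box↑ {Ψ} u) (toNf u)

  ⇒nf : ∀ {Φ L} (u : Content Φ L) → L ⇒ nf u
  ⇒nf u = ReducesToNf , closed , toNf u
    where
    closed : ∀ {M N} → ReducesToNf M N → Reduces ReducesToNf M N
    closed (toNf u) = reduces (⟶*result r) (tree-inside (nfSkeleton u) (result≈ r))
      where r = proj₂ (normaliseᶜ u)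

  -- Derivations from skeletons

  -- Together with `BoxedOnce`, the two occurrence patterns of a λ↓-bound variable: this one is
  -- typed by #, the other by ↓.
  Flat : ∀ {Ψ Φ} → ℕ → Skeleton Ψ Φ → ℕ → Set
  Flat n (var _ _)  y = ⊤
  Flat n (app S T)  y = Flat n S y × Flat n T y
  Flat n (bind _ S) y = Flat n S (suc y)
  Flat n (box↓ S)   y = wt n S y ≡ 0
  Flat n (box↑ _ _) y = ⊤

  BoxedOnce : ∀ {Ψ Φ} → ℕ → Skeleton Ψ Φ → ℕ → Set
  BoxedOnce n (var _ _)  y = ⊥
  BoxedOnce n (app S T)  y = (BoxedOnce n S y × wt n T y ≡ 0) ⊎ (wt n S y ≡ 0 × BoxedOnce n T y)
  BoxedOnce n (bind _ S) y = BoxedOnce n S (suc y)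
  BoxedOnce n (box↓ S)   y = wt n S y ≡ 1
  BoxedOnce n (box↑ _ _) y = ⊥

  boxedOnce-wt : ∀ {Ψ Φ} n (S : Skeleton Ψ Φ) y → BoxedOnce n S y → wt n S y ≡ n
  boxedOnce-wt n (app S T)  y (inj₁ (d , e)) =
    trans (cong₂ _+_ (boxedOnce-wt n S y d) e) (+-identityʳ n)
  boxedOnce-wt n (app S T)  y (inj₂ (e , d)) = cong₂ _+_ e (boxedOnce-wt n T y d)
  boxedOnce-wt n (bind _ S) y d = boxedOnce-wt n S (suc y) d
  boxedOnce-wt n (box↓ S)   y d = trans (cong (n *_) d) (*-identityʳ n)

  -- An occurrence inside a ↓-box already weighs at least `n`. Within a total of `n` it must
  -- therefore be the only one outside the ↑-boxes, under a single ↓-box.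
  flat⊎boxedOnce : ∀ {Ψ Φ} n → 2 ≤ n → (S : Skeleton Ψ Φ) → ∀ y → wt n S y ≤ n →
                   Flat n S y ⊎ BoxedOnce n S y
  flat⊎boxedOnce n h (var _ _) y l = inj₁ tt
  flat⊎boxedOnce n h (app S T) y l
    with flat⊎boxedOnce n h S y (≤-trans (m≤m+n _ (wt n T y)) l)
       | flat⊎boxedOnce n h T y (≤-trans (m≤n+m _ (wt n S y)) l)
  ... | inj₁ f | inj₁ g = inj₁ (f , g)
  ... | inj₂ d | _      = inj₂ (inj₁ (d , n≤0⇒n≡0 (+-cancelˡ-≤ n (wt n T y) 0
          (subst₂ (λ m k → m + wt n T y ≤ k) (boxedOnce-wt n S y d) (sym (+-identityʳ n)) l))))
  ... | inj₁ _ | inj₂ d = inj₂ (inj₂ (n≤0⇒n≡0 (+-cancelʳ-≤ n (wt n S y) 0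
          (subst (λ m → wt n S y + m ≤ n) (boxedOnce-wt n T y d) l)) , d))
  flat⊎boxedOnce n h (bind _ S) y l = flat⊎boxedOnce n h S (suc y) l
  flat⊎boxedOnce (suc n) h (box↓ S) y l
    with wt (suc n) S y
       | *-cancelˡ-≤ (suc n) (≤-trans l (≤-reflexive (sym (*-identityʳ (suc n)))))
  ... | zero        | _       = inj₁ refl
  ... | suc zero    | _       = inj₂ refl
  ... | suc (suc _) | s≤s ()
  flat⊎boxedOnce n h (box↑ _ _) y l = inj₁ tt

  -- The converse of `Permit` and `Weight`: what a slot asks of the skeleton for a derivation to be
  -- rebuilt. The flag `b` tells whether the variable is in scope inside the ↑-boxes, where its slot
  -- has to turn into †.
  Fit : ∀ {Ψ Φ} → ℕ → Slot → Bool → Skeleton Ψ Φ → ℕ → Set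
  Fit n nothing       b S y = b ≡ false × wt n S y ≡ 0
  Fit n (just plain)  b S y = b ≡ false × wt n S y ≡ 1
  Fit n (just hash)   b S y = b ≡ false × Flat n S y
  Fit n (just down)   b S y = b ≡ false × BoxedOnce n S y
  Fit n (just up)     b S y = b ≡ true × wt n S y ≡ 0
  Fit n (just dagger) b S y = b ≡ true

  VarFit : Slot → ℕ → Set
  VarFit nothing       m = m ≡ 0
  VarFit (just plain)  m = m ≡ 1
  VarFit (just hash)   m = ⊤
  VarFit (just down)   m = ⊥
  VarFit (just up)     m = m ≡ 0
  VarFit (just dagger) m = ⊤

  fit-var : ∀ {Ψ Φ} n s b x (e : x ∈ Ψ) y → Fit {Ψ} {Φ} n s b (var x e) y → VarFit s (δ x y)
  fit-var n nothing       b x e y (_ , w) = w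
  fit-var n (just plain)  b x e y (_ , w) = w
  fit-var n (just hash)   b x e y _       = tt
  fit-var n (just up)     b x e y (_ , w) = w
  fit-var n (just dagger) b x e y _       = tt

  varFit-shared : ∀ s → VarFit s 0 → Shared s
  varFit-shared nothing       _ = absent
  varFit-shared (just hash)   _ = hash
  varFit-shared (just up)     _ = up
  varFit-shared (just dagger) _ = dagger

  varFit-axiom : ∀ Γ x → (∀ y → VarFit (slot Γ y) (δ x y)) →
                 Axiom plain Γ x ⊎ Axiom hash Γ x ⊎ Axiom dagger Γ x
  varFit-axiom [] x h with () ← trans (sym (h x)) (δ-refl x)
  varFit-axiom (s ∷ Γ) zero h with s | h 0 | all-shared Γ (λ y → varFit-shared _ (h (suc y)))
  ... | just plain  | _ | t = inj₁ (here t)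
  ... | just hash   | _ | t = inj₂ (inj₁ (here t))
  ... | just dagger | _ | t = inj₂ (inj₂ (here t))
  varFit-axiom (s ∷ Γ) (suc x) h with varFit-shared s (h 0) | varFit-axiom Γ x (h ∘ suc)
  ... | q | inj₁ t        = inj₁ (there q t)
  ... | q | inj₂ (inj₁ t) = inj₂ (inj₁ (there q t))
  ... | q | inj₂ (inj₂ t) = inj₂ (inj₂ (there q t))

  fit-app : ∀ {Ψ Φ} n s b (S T : Skeleton Ψ Φ) y → Fit n s b (app S T) y →
            ∃₂ λ s₁ s₂ → SplitSlot s s₁ s₂ × Fit n s₁ b S y × Fit n s₂ b T y
  fit-app n nothing b S T y (e , w) =
    _ , _ , both absent , (e , m+n≡0⇒m≡0 _ w) , (e , m+n≡0⇒n≡0 (wt n S y) w)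
  fit-app n (just plain) b S T y (e , w) with m+n≡1-cases (wt n S y) w
  ... | inj₁ (p , q) = _ , _ , toʳ plain , (e , p) , (e , q)
  ... | inj₂ (p , q) = _ , _ , toˡ plain , (e , p) , (e , q)
  fit-app n (just hash) b S T y (e , f , g) = _ , _ , both hash , (e , f) , (e , g)
  fit-app n (just down) b S T y (e , inj₁ (d , w)) = _ , _ , toˡ down , (e , d) , (e , w)
  fit-app n (just down) b S T y (e , inj₂ (w , d)) = _ , _ , toʳ down , (e , w) , (e , d)
  fit-app n (just up) b S T y (e , w) =
    _ , _ , both up , (e , m+n≡0⇒m≡0 _ w) , (e , m+n≡0⇒n≡0 (wt n S y) w)
  fit-app n (just dagger) b S T y e = _ , _ , both dagger , e , e

  fit-bind : ∀ {Ψ Φ} n s b k S y → Fit n s b (bind {Ψ} {Φ} k S) y → Fit n s b S (suc y)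
  fit-bind n nothing       b k S y f = f
  fit-bind n (just plain)  b k S y f = f
  fit-bind n (just hash)   b k S y f = f
  fit-bind n (just down)   b k S y f = f
  fit-bind n (just up)     b k S y f = f
  fit-bind n (just dagger) b k S y f = f

  fit-box↓ : ∀ {Ψ Φ} n → 2 ≤ n → ∀ s b (S : Skeleton Ψ Φ) y → Fit n s b (box↓ S) y →
             ∃[ t ] Box↓Slot s t × Fit n t b S y
  fit-box↓ n h nothing       b S y (e , w) = _ , absent , e , n*m≤1⇒m≡0 _ h (≤-trans (≤-reflexive w) z≤n)
  -- Weights of a boxed skeleton are multiples of `n`, hence never 1.
  fit-box↓ n h (just plain)  b S y (e , w) = ⊥-elim (0≢1+n (begin
    0                ≡⟨ *-zeroʳ n ⟨
    n * 0            ≡⟨ cong (n *_) (n*m≤1⇒m≡0 _ h (≤-reflexive w)) ⟨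
    n * wt n S y     ≡⟨ w ⟩
    1                ∎))
    where open ≡-Reasoning
  fit-box↓ n h (just hash)   b S y (e , w) = _ , hash , e , w
  fit-box↓ n h (just down)   b S y (e , w) = _ , down , e , w
  fit-box↓ n h (just up)     b S y (e , w) = _ , up , e , n*m≤1⇒m≡0 _ h (≤-trans (≤-reflexive w) z≤n)
  fit-box↓ n h (just dagger) b S y e       = _ , dagger , e

  data DaggerSlot : Slot → Bool → Set where
    absent : DaggerSlot nothing false
    dagger : DaggerSlot (just dagger) true

  fit-box↑ : ∀ {Ψ Φ} n s b {L} (u : Content Φ L) y → Fit {Ψ} n s b (box↑ L u) y →
             ∃[ t ] Box↑Slot s t × DaggerSlot t b
  fit-box↑ n nothing       b u y (refl , _) = _ , absent , absent
  fit-box↑ n (just hash)   b u y (refl , _) = _ , hash , absent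
  fit-box↑ n (just up)     b u y (refl , _) = _ , up , dagger
  fit-box↑ n (just dagger) b u y refl       = _ , dagger , dagger

  -- The post-fixed point behind `⊢nf`; its environments consist of † patterns for exactly the
  -- variables in `Φ`.
  data TypedNf : Env → Preterm → Set where
    typedNf : ∀ {Δ Φ L} (u : Content Φ L) → (∀ y → DaggerSlot (slot Δ y) (Φ y)) → TypedNf Δ (nf u)

  -- Converse of `encode`. Since reduction preserves only `Good`, typability of the normal form is
  -- recovered from weights alone, without subject reduction for derivations.
  decode : ∀ {Ψ Φ} n → 2 ≤ n → (S : Skeleton Ψ Φ) → Good n S → ∀ Γ →
           (∀ y → Fit n (slot Γ y) (Φ y) S y) → Derivation TypedNf Γ (tree S)
  decode n h (var x e) G Γ f with varFit-axiom Γ x (λ y → fit-var n _ _ x e y (f y))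
  ... | inj₁ t        = vl ≈-refl t
  ... | inj₂ (inj₁ t) = vd ≈-refl t
  ... | inj₂ (inj₂ t) = va ≈-refl t
  decode n h (app S T) (G , H) Γ f
    with Δ₁ , Δ₂ , t , f₁ , f₂ ← choose-split Γ (λ y → fit-app n _ _ S T y (f y))
    = a (tree-app S T) t (decode n h S G Δ₁ f₁) (decode n h T H Δ₂ f₂)
  decode n h (bind lin S) (w , G) Γ f =
    ll (tree-bind lin S) (decode n h S G _ λ { zero → refl , w ; (suc y) → fit-bind n _ _ lin S y (f y) })
  -- The occurrence pattern of the bound variable selects between the two rules for λ↓.
  decode n h (bind ind S) (w , G) Γ f with flat⊎boxedOnce n h S 0 w
  ... | inj₁ q = li₁ (tree-bind ind S)
                   (decode n h S G _ λ { zero → refl , q ; (suc y) → fit-bind n _ _ ind S y (f y) })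
  ... | inj₂ q = li₂ (tree-bind ind S)
                   (decode n h S G _ λ { zero → refl , q ; (suc y) → fit-bind n _ _ ind S y (f y) })
  decode n h (bind coi S) (w , G) Γ f =
    lc (tree-bind coi S) (decode n h S G _ λ { zero → refl , w ; (suc y) → fit-bind n _ _ coi S y (f y) })
  decode n h (box↓ S) G Γ f
    with Δ , t , f′ ← choose-pointwise Γ (λ { absent → refl }) (λ y → fit-box↓ n h _ _ S y (f y))
    = mi (tree-box↓ S) t (decode n h S G Δ f′)
  decode {Ψ} n h (box↑ L u) G Γ f
    with Δ , t , q ← choose-pointwise Γ (λ { absent → refl }) (λ y → fit-box↑ {Ψ} n _ _ u y (f y))
    = mc (tree-box↑ {Ψ} u) t (typedNf u q)

  wt-absent : ∀ {Ψ Φ} n (S : Skeleton Ψ Φ) y → Ψ y ≡ false → wt n S y ≡ 0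
  wt-absent n (var x e)  y h with δ≡0⊎≡ x y
  ... | inj₁ z    = z
  ... | inj₂ refl with () ← trans (sym e) h
  wt-absent n (app S T)  y h = cong₂ _+_ (wt-absent n S y h) (wt-absent n T y h)
  wt-absent n (bind k S) y h = wt-absent n S (suc y) h
  wt-absent n (box↓ S)   y h = trans (cong (n *_) (wt-absent n S y h)) (*-zeroʳ n)
  wt-absent n (box↑ _ _) y h = refl

  -- A † slot constrains no weight; a variable outside `Φ` has weight 0, because both scopes of the
  -- skeleton are `Φ`.
  daggerSlot-fit : ∀ {Φ} n (S : Skeleton Φ Φ) y {s b} → b ≡ Φ y → DaggerSlot s b → Fit n s b S y
  daggerSlot-fit n S y e absent = refl , wt-absent n S y (sym e)
  daggerSlot-fit n S y e dagger = refl

  ⊢nf : ∀ {Φ L} (u : Content Φ L) Δ → (∀ y → DaggerSlot (slot Δ y) (Φ y)) → Δ ⊢ nf u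
  ⊢nf u Δ q = TypedNf , closed , typedNf u q
    where
    closed : ∀ {Δ M} → TypedNf Δ M → Derivation TypedNf Δ M
    closed {Δ} (typedNf u q) =
      decode (base u) (2≤base u) (nfSkeleton u) (goodⁿ (proj₂ (normaliseᶜ u))) Δ
        λ y → daggerSlot-fit (base u) (nfSkeleton u) y refl (q y)

-- From a typed term to its normal form

inScope : Env → VarSet
inScope []      y       = false
inScope (_ ∷ Γ) zero    = true
inScope (_ ∷ Γ) (suc y) = inScope Γ y

permit-inScope : ∀ Γ y → Permit (inScope Γ y) (inScope Γ y) (slot Γ y)
permit-inScope []                _       = tt
permit-inScope (nothing ∷ Γ)     zero    = tt
permit-inScope (just plain ∷ Γ)  zero    = refl
permit-inScope (just down ∷ Γ)   zero    = refl
permit-inScope (just up ∷ Γ)     zero    = refl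
permit-inScope (just hash ∷ Γ)   zero    = refl
permit-inScope (just dagger ∷ Γ) zero    = refl , refl
permit-inScope (_ ∷ Γ)           (suc y) = permit-inScope Γ y

mainTheorem15 : ∀ (M : Preterm) → Term M → ∃[ N ] (NormalForm N × Term N × M ⇒ N)
mainTheorem15 M (Γ , X , unfoldˣ , x) =
  nf content , nf-normal content ,
  (_ , ⊢nf content (map (λ _ → just dagger) Γ) (daggers Γ)) , ⇒nf content
  where
  open Normalisation X unfoldˣ
  -- Every pattern may be replaced by a † pattern.
  content : Content (inScope Γ) M
  content = baseᶜ x (permit-inScope Γ)
  daggers : ∀ Γ y → DaggerSlot (slot (map (λ _ → just dagger) Γ) y) (inScope Γ y)
  daggers []      y       = absent
  daggers (_ ∷ Γ) zero    = dagger
  daggers (_ ∷ Γ) (suc y) = daggers Γ y
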